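{- For $0<\varepsilon<\frac{1}{121}$, Algorithm Enhanced-ED-Approx (run on $S,S',N_1,N_2,\mathrm{Dec}_{\mathcal C_1},\mathrm{Dec}_{\mathcal C_2}$) computes a set of up to $(1+23\varepsilon)\cdot\mathrm{ED}(S,S')$ insertions and deletions that turn $S$ into $S'$.
   Context: $\mathrm{ED}(A,B)$ is the minimum number of single-character insertions and deletions (no substitutions) needed to transform $A$ into $B$. Setting. For $t=1,2$, $\mathcal C_t$ is an insertion-deletion code of block length $N_t$ and rate $r_t$ over alphabet $\Sigma_{\mathcal C_t}$ that is $L_t$-list decodable from $N_t(1-\varepsilon)$ insertions and $N_t(1-\varepsilon)$ deletions: for a string $y$, the decoder output $\mathrm{Dec}_{\mathcal C_t}(y)$ is the set (of size at most $L_t$) of all indices $j$ such that the $j$-th codeword of $\mathcal C_t$ can be turned into $y$ by $N_t(1-\varepsilon)$ deletions and $N_t(1-\varepsilon)$ insertions. Let $I'$ be the concatenation of all codewords of $\mathcal C_2$, of length $|I'|=N_2|\Sigma_{\mathcal C_2}|^{N_2r_2}$; the block length of $\mathcal C_1$ is $N_1=|I'|$. Let $I_1$ be the concatenation of all codewords of $\mathcal C_1$, $I_2$ the string $I'$ repeated $|\mathcal C_1|$ times, and $I$ the string with $i$-th symbol $((I_1)_i,(I_2)_i)$. $S$ is the string with $i$-th symbol $(m_i,I_i)$ for an arbitrary content string $m$ with $|m|=|I|$; $S'$ is a given string over the same product alphabet. $S$ and $S'$ are split into consecutive blocks $S(i),S'(i)$ of length $N_1$, and each block is split into consecutive sub-blocks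 of length $N_2$: $S(k,k')$ denotes the $k'$-th sub-block of $S(k)$ and $S'(i,i')$ the $i'$-th sub-block of $S'(i)$. $C'_i$ is the $\mathcal C_1$-index component of $S'(i)$, and $C''_{i,i'}$ is the $\mathcal C_2$-index component of $S'(i,i')$. Algorithm Enhanced-ED-Approx. Let $w=1/\varepsilon$. Start with an empty bipartite graph $G$ with parts of size $|S|$ and $|S'|$, whose vertices are the positions of $S$ and of $S'$. For each block $S'(i)$: set $List_1\leftarrow\mathrm{Dec}_{\mathcal C_1}(C'_i)$; for each $j\in List_1$, for each $k\in[j-w,j+w]$, for each $i'\in[1,N_1/N_2]$: set $List_2\leftarrow\mathrm{Dec}_{\mathcal C_2}(C''_{i,i'})$; for each $j'\in List_2$ and each $k'\in[j'-w,j'+w]$, connect any pair of vertices of $G$ that correspond to identical symbols in $S(k,k')$ and $S'(i,i')$. Finally return a largest non-crossing matching of $G$ (a set of edges $(u_{i_1},v_{j_1}),\dots,(u_{i_t},v_{j_t})$ with $i_1<\dots<i_t$, $j_1<\dots<j_t$). The returned matching is identified with the set of operations that deletes every unmatched symbol of $S$ and inserts every unmatched symbol of $S'$.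
   Formalization: ε is rational; |S′| is a multiple of N₁ (only full blocks); for k′ outside [1, N₁/N₂] the sub-block S(k,k′) is read by continuing the numbering into adjacent blocks of S, since the claim fails if such k′ are skipped. Sub-block numbers k′ outside 1..N₁/N₂, for which S(k,k′) is undefined, are read as continuing into adjacent blocks (if skipped, the claim fails); the length of S′ is taken to be a multiple of N₁ (a partial last block breaks the claim); ε is rational, from which real ε follows. -}

module Defs where

open import Data.Nat.Base as ℕ using (ℕ; zero; suc)
open import Data.Integer.Base as ℤ using (ℤ; +_)
open import Data.Rational.Base using (ℚ; 0ℚ; 1ℚ; _/_; 1/_; _+_; _-_; _*_; _≤_; _<_; >-nonZero)
open import Data.Fin.Base as Fin using (Fin; toℕ; combine)
open import Data.Fin.Properties using (_≟_)
open import Data.List.Base as List using (List; []; _∷_; _++_; length; take; drop; reverse; filter; allFin)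
open import Data.List.Membership.Propositional using (_∈_)
open import Data.List.Membership.DecPropositional using (_∈?_)
open import Data.List.Relation.Unary.All using (All)
open import Data.List.Relation.Unary.Linked using (Linked)
open import Data.List.Relation.Unary.Unique.Propositional using (Unique)
open import Data.Product.Base using (_×_; _,_; ∃; ∃-syntax; proj₁; proj₂)
open import Data.Vec.Base as Vec using (Vec; lookup; tabulate; concat; replicate; toList; zip)
open import Function.Base using (_∘_)
open import Function.Bundles using (_⇔_)
open import Function.Definitions using (Injective)
open import Relation.Binary.PropositionalEquality.Core using (_≡_)
open import Relation.Nullary.Decidable.Core using (¬?)

private
  variable
    A : Set
    n n′ : ℕ

fromℤ : ℤ → ℚ
fromℤ z = z / 1

fromℕ : ℕ → ℚ
fromℕ = fromℤ ∘ +_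

------------------------------------------------------------------------
-- Insertions, deletions and edit distance

-- Positions are 0-based and refer to the string the operation is applied
-- to.  A deletion beyond the end has no effect but is still counted, and an
-- insertion beyond the end appends, so neither affects a minimum.
data Op (A : Set) : Set where
  delete : ℕ → Op A
  insert : ℕ → A → Op A

apply : Op A → List A → List A
apply (delete p)   xs = take p xs ++ drop (suc p) xs
apply (insert p a) xs = take p xs ++ a ∷ drop p xs

run : List (Op A) → List A → List A
run []       xs = xs
run (o ∷ os) xs = run os (apply o xs)

#deletions : List (Op A) → ℕ
#deletions []                = 0
#deletions (delete _ ∷ os)   = suc (#deletions os)
#deletions (insert _ _ ∷ os) = #deletions os

#insertions : List (Op A) → ℕ
#insertions []                = 0
#insertions (delete _ ∷ os)   = #insertions os
#insertions (insert _ _ ∷ os) = suc (#insertions os)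

-- IsED xs ys d:  ED(xs , ys) = d.
IsED : List A → List A → ℕ → Set
IsED xs ys d =
    (∃[ os ] run os xs ≡ ys × length os ≡ d)
  × (∀ os → run os xs ≡ ys → d ℕ.≤ length os)

-- xs can be turned into ys by (at most) b deletions and (at most) b
-- insertions; b need not be an integer.
Within : ℚ → List A → List A → Set
Within b xs ys =
  ∃[ os ] run os xs ≡ ys × fromℕ (#deletions os) ≤ b × fromℕ (#insertions os) ≤ b

------------------------------------------------------------------------
-- Codes and list decoding

-- A code with M codewords of length N over an alphabet of q symbols.  Its
-- rate is the real number r with M = q ^ (N r); it only enters through M.
record Code (q N M : ℕ) : Set where
  field
    codeword  : Fin M → Vec (Fin q) N
    injective : Injective _≡_ _≡_ codeword

  concatenation : Vec (Fin q) (M ℕ.* N)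
  concatenation = concat (tabulate codeword)

open Code public

-- A decoder witnessing that C is L-list decodable from N(1 - ε) insertions
-- and N(1 - ε) deletions.
record ListDecoder {q N M : ℕ} (C : Code q N M) (ε : ℚ) (L : ℕ) : Set where
  field
    dec    : List (Fin q) → List (Fin M)
    spec   : ∀ y j →
             j ∈ dec y ⇔ Within (fromℕ N * (1ℚ - ε)) (toList (codeword C j)) y
    unique : ∀ y → Unique (dec y)
    bound  : ∀ y → length (dec y) ℕ.≤ L

open ListDecoder public

------------------------------------------------------------------------
-- The matching returned by the algorithm, and its operations

Graph : ℕ → ℕ → Set₁
Graph n n′ = Fin n → Fin n′ → Set

Matching : ℕ → ℕ → Set
Matching n n′ = List (Fin n × Fin n′)

record NonCrossing (G : Graph n n′) (μ : Matching n n′) : Set where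
  field
    edges  : All (λ (u , v) → G u v) μ
    sorted : Linked (λ (u , v) (u′ , v′) → u Fin.< u′ × v Fin.< v′) μ

record LargestNonCrossing (G : Graph n n′) (μ : Matching n n′) : Set where
  field
    nonCrossing : NonCrossing G μ
    largest     : ∀ ν → NonCrossing G ν → length ν ℕ.≤ length μ

unmatched : List (Fin n) → List (Fin n)
unmatched us = filter (λ u → ¬? (_∈?_ _≟_ u us)) (allFin _)

-- Delete the unmatched symbols of S and insert those of S′.  Deletions are
-- listed from right to left, so that each position is one of S, and then
-- insertions from left to right, so that each position is one of S′.
operations : Vec A n′ → Matching n n′ → List (Op A)
operations S′ μ =
     List.map (λ u → delete (toℕ u)) (reverse (unmatched (List.map proj₁ μ)))
  ++ List.map (λ v → insert (toℕ v) (lookup S′ v)) (unmatched (List.map proj₂ μ))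

------------------------------------------------------------------------
-- The two-level indexing and the algorithm

-- The block length of C₁ is |I′| = M₂ * N₂, where I′ = concatenation C₂.
-- A block thus has M₂ = N₁ / N₂ sub-blocks.
module _ {q₁ q₂ M₁ M₂ N₂ : ℕ}
         (C₂ : Code q₂ N₂ M₂) (C₁ : Code q₁ (M₂ ℕ.* N₂) M₁) where

  indexString : Vec (Fin q₁ × Fin q₂) (M₁ ℕ.* (M₂ ℕ.* N₂))
  indexString = zip (concatenation C₁) (concat (replicate M₁ (concatenation C₂)))

Symbol : Set → ℕ → ℕ → Set
Symbol A q₁ q₂ = A × (Fin q₁ × Fin q₂)

-- z ∈ [ c - w , c + w ]
InWindow : (w : ℚ) (c z : ℤ) → Set
InWindow w c z = fromℤ c - w ≤ fromℤ z × fromℤ z ≤ fromℤ c + w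

-- Position u of S lies in S(k , k′), all 0-based: the sub-block of length N₂
-- starting k′ N₂ symbols after the beginning of block S(k).  For k′ outside
-- [0 , M₂) the numbering of sub-blocks continues into the neighbouring
-- blocks, e.g. S(k , -1) is the last sub-block of S(k - 1).  Without this, a
-- short prefix inserted before S, which makes the sub-blocks of S′ straddle
-- the boundaries of blocks of S, could cost edges at every such boundary.
InSubBlock : (N₂ M₂ : ℕ) (k : ℕ) (k′ : ℤ) (u : ℕ) → Set
InSubBlock N₂ M₂ k k′ u =
  ∃ λ (ℓ : Fin N₂) → + u ≡ + (k ℕ.* (M₂ ℕ.* N₂)) ℤ.+ k′ ℤ.* + N₂ ℤ.+ + toℕ ℓ

-- S′ consists of n full blocks, n arbitrary.  (A final block shorter than
-- ε N₁ could never be decoded, even if S′ ends exactly like S.)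
module EnhancedEDApprox
  {A : Set} {q₁ q₂ M₁ M₂ N₂ L₁ L₂ : ℕ} {ε : ℚ} (0<ε : 0ℚ < ε)
  {C₁ : Code q₁ (M₂ ℕ.* N₂) M₁} {C₂ : Code q₂ N₂ M₂}
  (Dec₁ : ListDecoder C₁ ε L₁) (Dec₂ : ListDecoder C₂ ε L₂)
  (S  : Vec (Symbol A q₁ q₂) (M₁ ℕ.* (M₂ ℕ.* N₂)))
  (n : ℕ) (S′ : Vec (Symbol A q₁ q₂) (n ℕ.* (M₂ ℕ.* N₂)))
  where

  w : ℚ
  w = 1/_ ε {{>-nonZero 0<ε}}

  block : Fin n → Vec (Symbol A q₁ q₂) (M₂ ℕ.* N₂)
  block i = tabulate (λ x → lookup S′ (combine i x))

  subBlock : Fin n → Fin M₂ → Vec (Symbol A q₁ q₂) N₂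
  subBlock i i′ = tabulate (λ x → lookup (block i) (combine i′ x))

  -- The components C′ᵢ and C″ᵢ,ᵢ′ that are passed to the decoders.
  index₁ : Fin n → List (Fin q₁)
  index₁ i = toList (Vec.map (proj₁ ∘ proj₂) (block i))

  index₂ : Fin n → Fin M₂ → List (Fin q₂)
  index₂ i i′ = toList (Vec.map (proj₂ ∘ proj₂) (subBlock i i′))

  -- The graph after all loops: u and v are connected iff some iteration
  -- (i , j , k , i′ , j′ , k′) connects them.
  record G (u : Fin (M₁ ℕ.* (M₂ ℕ.* N₂))) (v : Fin (n ℕ.* (M₂ ℕ.* N₂))) : Set where
    field
      i      : Fin n
      j      : Fin M₁
      j∈     : j ∈ dec Dec₁ (index₁ i)
      k      : Fin M₁
      k∈     : InWindow w (+ toℕ j) (+ toℕ k)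
      i′     : Fin M₂
      j′     : Fin M₂
      j′∈    : j′ ∈ dec Dec₂ (index₂ i i′)
      k′     : ℤ
      k′∈    : InWindow w (+ toℕ j′) k′
      u∈     : InSubBlock N₂ M₂ (toℕ k) k′ (toℕ u)
      v∈     : ∃ λ ℓ → v ≡ combine i (combine i′ ℓ)
      equal  : lookup S u ≡ lookup S′ v

  Returns : Matching (M₁ ℕ.* (M₂ ℕ.* N₂)) (n ℕ.* (M₂ ℕ.* N₂)) → Set
  Returns = LargestNonCrossing G

{-# OPTIONS --safe #-}
module Submission where

open import Defs
open import Data.Fin.Base as Fin using (Fin; zero; suc; toℕ; fromℕ<; combine; remQuot)
open import Data.Fin.Properties as Fin using ()
open import Data.Integer.Base as ℤ using (+_; +≤+; +<+)
open import Data.Integer.Properties as ℤ using ()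
import Data.Integer.Tactic.RingSolver as ℤ-Solver
open import Data.List.Base as List using (List; []; _∷_; _++_; length; map; reverse; filter; allFin)
open import Data.List.Membership.Propositional using (_∈_)
open import Data.List.Membership.DecPropositional using (_∈?_)
open import Data.List.Membership.Propositional.Properties using (∈-allFin)
open import Data.List.Properties
  using (map-tabulate; map-++; map-∘; reverse-map; unfold-reverse; length-map; length-reverse;
         length-tabulate; filter-accept; filter-reject; filter-none)
open import Data.List.Relation.Unary.All as All using (All; []; _∷_)
open import Data.List.Relation.Unary.AllPairs as AllPairs using (AllPairs; []; _∷_)
open import Data.List.Relation.Unary.AllPairs.Properties as AllPairs using ()
open import Data.List.Relation.Unary.Any using (here; there)
open import Data.List.Relation.Unary.Linked.Properties using (Linked⇒AllPairs; AllPairs⇒Linked)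
open import Data.Nat.Base as ℕ using (ℕ; zero; suc; _+_; _*_; _∸_; _≤_; _<_; z≤n; s≤s; >-nonZero)
open import Data.Nat.DivMod as ℕ using ()
open import Data.Nat.Properties as ℕ using ()
open import Data.Nat.Tactic.RingSolver using (solve-∀)
open import Data.Product.Base using (_×_; _,_; proj₁; proj₂; ∃; ∃₂)
open import Data.Rational.Base as ℚ using (ℚ; 0ℚ; 1ℚ; mkℚ; _/_; 1/_; *<*; toℚᵘ; ↥_; ↧ₙ_; positive)
open import Data.Rational.Properties as ℚ using ()
open import Data.Rational.Solver using (module +-*-Solver)
open import Data.Rational.Unnormalised.Base as ℚᵘ using (mkℚᵘ; _≃_; *≡*)
open import Data.Rational.Unnormalised.Properties as ℚᵘ using ()
open import Data.Sum.Base using (_⊎_; inj₁; inj₂)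
open import Data.Vec.Base as Vec using (Vec; []; _∷_; lookup; toList; zip; concat; replicate; tabulate)
open import Data.Vec.Properties using (lookup-zip; lookup-concat; lookup-replicate; lookup-map; lookup∘tabulate)
open import Function.Base using (_∘_; id)
open import Function.Bundles using (Equivalence)
open import Level using (0ℓ)
open import Relation.Binary.PropositionalEquality
open import Relation.Nullary using (¬_; yes; no; contradiction)
open import Relation.Nullary.Decidable.Core using (¬?)
open import Relation.Unary using (Pred; Decidable)

-- An optimal alignment of S and S′ is cut into one piece per block of S′.  If
-- a piece has E matches and D unmatched symbols and touches T blocks of S, then
-- T N₁ ≤ 2 D + 3 E.  Either one of these blocks has at least ε N₁ matches with the
-- block of S′, so that it is decoded and, if T - 1 ≤ 1 / ε, all blocks that are
-- touched lie in the window around it; or E ≤ T ε N₁ ≤ ε (2 D + 3 E), and then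
-- unmatching the whole piece costs only 2 E = O(ε D) more operations.  The
-- pieces of the first kind are cut again along the sub-blocks and treated in the
-- same way.  What survives is a non-crossing matching of G, and each piece is
-- unmatched at most once, so the relative loss does not add up over the levels.

private
  variable
    A B : Set
    n n′ : ℕ
    P Q : ℕ → ℕ → Set
    u v u′ v′ u″ v″ D E D′ E′ : ℕ

-- Operations of a matching

run-++ : (os os′ : List (Op A)) (xs : List A) → run (os ++ os′) xs ≡ run os′ (run os xs)
run-++ []       os′ xs = refl
run-++ (o ∷ os) os′ xs = run-++ os os′ (apply o xs)

shift : Op A → Op A
shift (delete p)   = delete (suc p)
shift (insert p a) = insert (suc p) a

run-shift : (os : List (Op A)) (x : A) (xs : List A) → run (map shift os) (x ∷ xs) ≡ x ∷ run os xs
run-shift []                x xs = refl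
run-shift (delete p ∷ os)   x xs = run-shift os x _
run-shift (insert p a ∷ os) x xs = run-shift os x _

filter-map : {P : Pred B 0ℓ} (P? : Decidable P) (f : A → B) (xs : List A) →
             filter P? (map f xs) ≡ map f (filter (P? ∘ f) xs)
filter-map P? f []       = refl
filter-map P? f (x ∷ xs) with P? (f x)
... | yes _ = cong (f x ∷_) (filter-map P? f xs)
... | no  _ = filter-map P? f xs

filter-tabulate-suc : {P : Pred (Fin (suc n)) 0ℓ} (P? : Decidable P) →
                      filter P? (List.tabulate suc) ≡ map suc (filter (P? ∘ suc) (allFin n))
filter-tabulate-suc P? =
  trans (cong (filter P?) (sym (map-tabulate id suc))) (filter-map P? suc (allFin _))

deletions : List (Fin n) → List (Op A)
deletions ds = map (λ u → delete (toℕ u)) (reverse ds)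

deletions-map-suc : (ds : List (Fin n)) → deletions {A = A} (map suc ds) ≡ map shift (deletions ds)
deletions-map-suc ds = begin
  map (λ u → delete (toℕ u)) (reverse (map suc ds))   ≡⟨ cong (map _) (reverse-map suc ds) ⟨
  map (λ u → delete (toℕ u)) (map suc (reverse ds))   ≡⟨ map-∘ (reverse ds) ⟨
  map (shift ∘ λ u → delete (toℕ u)) (reverse ds)     ≡⟨ map-∘ (reverse ds) ⟩
  map shift (deletions ds)                            ∎
  where open ≡-Reasoning

run-deletions : (X : Vec A n) {P : Pred (Fin n) 0ℓ} (P? : Decidable P) →
                run (deletions (filter (¬? ∘ P?) (allFin n))) (toList X) ≡
                map (lookup X) (filter P? (allFin n))
run-deletions []       P? = refl
run-deletions {n = suc n} (x ∷ X) {P} P? = cases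
  where
  open ≡-Reasoning
  ds = filter (¬? ∘ P? ∘ suc) (allFin n)
  kept = filter (P? ∘ suc) (allFin n)

  tail : run (deletions (map suc ds)) (x ∷ toList X) ≡ x ∷ map (lookup X) kept
  tail = begin
    run (deletions (map suc ds)) (x ∷ toList X)   ≡⟨ cong (λ os → run os _) (deletions-map-suc ds) ⟩
    run (map shift (deletions ds)) (x ∷ toList X) ≡⟨ run-shift (deletions ds) x _ ⟩
    x ∷ run (deletions ds) (toList X)             ≡⟨ cong (x ∷_) (run-deletions X (P? ∘ suc)) ⟩
    x ∷ map (lookup X) kept                       ∎

  cases : run (deletions (filter (¬? ∘ P?) (allFin (suc n)))) (x ∷ toList X) ≡
          map (lookup (x ∷ X)) (filter P? (allFin (suc n)))
  cases with P? zero
  ... | yes _ rewrite filter-tabulate-suc P? | filter-tabulate-suc (¬? ∘ P?) =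
    trans tail (cong (x ∷_) (map-∘ kept))
  ... | no  _ rewrite filter-tabulate-suc P? | filter-tabulate-suc (¬? ∘ P?) = begin
    run (deletions (zero ∷ map suc ds)) (x ∷ toList X)
      ≡⟨ cong (λ us → run (map _ us) _) (unfold-reverse zero (map suc ds)) ⟩
    run (map _ (reverse (map suc ds) ++ zero ∷ [])) (x ∷ toList X)
      ≡⟨ cong (λ os → run os _) (map-++ _ (reverse (map suc ds)) _) ⟩
    run (deletions (map suc ds) ++ delete 0 ∷ []) (x ∷ toList X)
      ≡⟨ run-++ (deletions (map suc ds)) _ _ ⟩
    apply (delete 0) (run (deletions (map suc ds)) (x ∷ toList X))
      ≡⟨ cong (apply (delete 0)) tail ⟩
    map (lookup X) kept
      ≡⟨ map-∘ kept ⟩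
    map (lookup (x ∷ X)) (map suc kept) ∎

insertions : Vec A n → List (Fin n) → List (Op A)
insertions Y is = map (λ v → insert (toℕ v) (lookup Y v)) is

run-insertions : (Y : Vec A n) {P : Pred (Fin n) 0ℓ} (P? : Decidable P) →
                 run (insertions Y (filter (¬? ∘ P?) (allFin n))) (map (lookup Y) (filter P? (allFin n))) ≡
                 toList Y
run-insertions []       P? = refl
run-insertions {n = suc n} (y ∷ Y) {P} P? = cases
  where
  open ≡-Reasoning
  is = filter (¬? ∘ P? ∘ suc) (allFin n)
  kept = filter (P? ∘ suc) (allFin n)

  tail : run (insertions (y ∷ Y) (map suc is)) (y ∷ map (lookup (y ∷ Y)) (map suc kept)) ≡ y ∷ toList Y
  tail = begin
    run (insertions (y ∷ Y) (map suc is)) (y ∷ map (lookup (y ∷ Y)) (map suc kept))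
      ≡⟨ cong₂ (λ os xs → run os (y ∷ xs)) (trans (sym (map-∘ is)) (map-∘ is)) (sym (map-∘ kept)) ⟩
    run (map shift (insertions Y is)) (y ∷ map (lookup Y) kept)
      ≡⟨ run-shift (insertions Y is) y _ ⟩
    y ∷ run (insertions Y is) (map (lookup Y) kept)
      ≡⟨ cong (y ∷_) (run-insertions Y (P? ∘ suc)) ⟩
    y ∷ toList Y ∎

  cases : run (insertions (y ∷ Y) (filter (¬? ∘ P?) (allFin (suc n))))
              (map (lookup (y ∷ Y)) (filter P? (allFin (suc n)))) ≡ y ∷ toList Y
  cases with P? zero
  ... | yes _ rewrite filter-tabulate-suc P? | filter-tabulate-suc (¬? ∘ P?) = tail
  ... | no  _ rewrite filter-tabulate-suc P? | filter-tabulate-suc (¬? ∘ P?) = tail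

filter-cong-local : {P Q : Pred A 0ℓ} (P? : Decidable P) (Q? : Decidable Q) {xs : List A} →
                    All (λ x → (P x → Q x) × (Q x → P x)) xs → filter P? xs ≡ filter Q? xs
filter-cong-local P? Q? [] = refl
filter-cong-local P? Q? {x ∷ xs} ((P⇒Q , Q⇒P) ∷ P⇔Q) with P? x | Q? x
... | yes _ | yes _ = cong (x ∷_) (filter-cong-local P? Q? P⇔Q)
... | no  _ | no  _ = filter-cong-local P? Q? P⇔Q
... | yes p | no ¬q = contradiction (P⇒Q p) ¬q
... | no ¬p | yes q = contradiction (Q⇒P q) ¬p

filter-∈-increasing : {us zs : List (Fin n)} → AllPairs Fin._<_ us → AllPairs Fin._<_ zs →
                      (∀ {u} → u ∈ us → u ∈ zs) →
                      filter (λ z → _∈?_ Fin._≟_ z us) zs ≡ us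
filter-∈-increasing {us = []} {zs} _ _ _ = filter-none (λ z → _∈?_ Fin._≟_ z []) {xs = zs} (All.tabulate λ _ ())
filter-∈-increasing {us = u ∷ us} {[]} _ _ us⊆zs with () ← us⊆zs (here refl)
filter-∈-increasing {us = u ∷ us} {z ∷ zs} (u< ∷ us↗) (z< ∷ zs↗) us⊆zs with u Fin.≟ z
... | yes refl = trans (filter-accept _ {xs = zs} (here refl)) (cong (u ∷_) (trans
    (filter-cong-local (λ z → _∈?_ Fin._≟_ z (u ∷ us)) (λ z → _∈?_ Fin._≟_ z us) (All.map same z<))
    (filter-∈-increasing us↗ zs↗ us⊆)))
  where
  us⊆ : ∀ {x} → x ∈ us → x ∈ zs
  us⊆ x∈ with us⊆zs (there x∈)
  ... | here refl = contradiction (All.lookup u< x∈) (Fin.<-irrefl refl)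
  ... | there x∈zs = x∈zs

  same : ∀ {x} → u Fin.< x → (x ∈ u ∷ us → x ∈ us) × (x ∈ us → x ∈ u ∷ us)
  same u<x = (λ { (here refl) → contradiction u<x (Fin.<-irrefl refl) ; (there x∈) → x∈ }) , there
... | no u≢z = trans (filter-reject _ {xs = zs} z∉) (filter-∈-increasing (u< ∷ us↗) zs↗ us⊆)
  where
  z<u : z Fin.< u
  z<u with us⊆zs (here refl)
  ... | here u≡z = contradiction u≡z u≢z
  ... | there u∈zs = All.lookup z< u∈zs

  z∉ : ¬ z ∈ u ∷ us
  z∉ (here z≡u) = u≢z (sym z≡u)
  z∉ (there z∈us) = Fin.<-irrefl refl (Fin.<-trans z<u (All.lookup u< z∈us))

  us⊆ : ∀ {x} → x ∈ u ∷ us → x ∈ zs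
  us⊆ x∈ with us⊆zs x∈
  ... | here refl = contradiction x∈ z∉
  ... | there x∈zs = x∈zs

filter-∈-allFin : {us : List (Fin n)} → AllPairs Fin._<_ us →
                  filter (λ z → _∈?_ Fin._≟_ z us) (allFin n) ≡ us
filter-∈-allFin us↗ = filter-∈-increasing us↗ (AllPairs.tabulate⁺-< id) λ _ → ∈-allFin _

length-filter-¬ : {P : Pred A 0ℓ} (P? : Decidable P) (xs : List A) →
                  length (filter (¬? ∘ P?) xs) + length (filter P? xs) ≡ length xs
length-filter-¬ P? []       = refl
length-filter-¬ P? (x ∷ xs) with P? x
... | yes _ = trans (ℕ.+-suc _ _) (cong suc (length-filter-¬ P? xs))
... | no  _ = cong suc (length-filter-¬ P? xs)

length-unmatched : {us : List (Fin n)} → AllPairs Fin._<_ us → length (unmatched us) + length us ≡ n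
length-unmatched {n} {us} us↗ = begin
  length (unmatched us) + length us
    ≡⟨ cong (λ vs → length (unmatched us) + length vs) (filter-∈-allFin us↗) ⟨
  length (unmatched us) + length (filter (λ z → _∈?_ Fin._≟_ z us) (allFin n))
    ≡⟨ length-filter-¬ (λ z → _∈?_ Fin._≟_ z us) (allFin n) ⟩
  length (allFin n)
    ≡⟨ length-tabulate {n = n} id ⟩
  n ∎
  where open ≡-Reasoning

#deletions-++ : (os os′ : List (Op A)) → #deletions (os ++ os′) ≡ #deletions os + #deletions os′
#deletions-++ []                os′ = refl
#deletions-++ (delete _ ∷ os)   os′ = cong suc (#deletions-++ os os′)
#deletions-++ (insert _ _ ∷ os) os′ = #deletions-++ os os′

#insertions-++ : (os os′ : List (Op A)) → #insertions (os ++ os′) ≡ #insertions os + #insertions os′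
#insertions-++ []                os′ = refl
#insertions-++ (delete _ ∷ os)   os′ = #insertions-++ os os′
#insertions-++ (insert _ _ ∷ os) os′ = cong suc (#insertions-++ os os′)

length≡#deletions+#insertions : (os : List (Op A)) → length os ≡ #deletions os + #insertions os
length≡#deletions+#insertions []                = refl
length≡#deletions+#insertions (delete _ ∷ os)   = cong suc (length≡#deletions+#insertions os)
length≡#deletions+#insertions (insert _ _ ∷ os) =
  trans (cong suc (length≡#deletions+#insertions os)) (sym (ℕ.+-suc _ _))

#deletions-deletions : (us : List (Fin n)) → #deletions (map {B = Op A} (λ u → delete (toℕ u)) us) ≡ length us
#deletions-deletions []       = refl
#deletions-deletions (_ ∷ us) = cong suc (#deletions-deletions us)

#insertions-deletions : (us : List (Fin n)) → #insertions (map {B = Op A} (λ u → delete (toℕ u)) us) ≡ 0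
#insertions-deletions []       = refl
#insertions-deletions (_ ∷ us) = #insertions-deletions us

#deletions-insertions : (Y : Vec A n) (vs : List (Fin n)) → #deletions (insertions Y vs) ≡ 0
#deletions-insertions Y []       = refl
#deletions-insertions Y (_ ∷ vs) = #deletions-insertions Y vs

#insertions-insertions : (Y : Vec A n) (vs : List (Fin n)) → #insertions (insertions Y vs) ≡ length vs
#insertions-insertions Y []       = refl
#insertions-insertions Y (_ ∷ vs) = cong suc (#insertions-insertions Y vs)

module _ {G : Graph n n′} {μ : Matching n n′} (nc : NonCrossing G μ) where

  increasing : AllPairs (λ (u , v) (u′ , v′) → u Fin.< u′ × v Fin.< v′) μ
  increasing = Linked⇒AllPairs
    (λ (u< , v<) (u′< , v′<) → Fin.<-trans u< u′< , Fin.<-trans v< v′<) (NonCrossing.sorted nc)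

  increasing₁ : AllPairs Fin._<_ (map proj₁ μ)
  increasing₁ = AllPairs.map⁺ (AllPairs.map proj₁ increasing)

  increasing₂ : AllPairs Fin._<_ (map proj₂ μ)
  increasing₂ = AllPairs.map⁺ (AllPairs.map proj₂ increasing)

  module _ (Y : Vec A n′) where
    open ≡-Reasoning

    #deletions-operations : #deletions (operations Y μ) + length μ ≡ n
    #deletions-operations = begin
      #deletions (operations Y μ) + length μ
        ≡⟨ cong (_+ length μ) (#deletions-++ (deletions ds) _) ⟩
      #deletions (deletions {A = A} ds) + #deletions (insertions Y is) + length μ
        ≡⟨ cong (_+ length μ) (cong₂ _+_ (#deletions-deletions (reverse ds)) (#deletions-insertions Y is)) ⟩
      length (reverse ds) + 0 + length μ
        ≡⟨ cong₂ _+_ (trans (ℕ.+-identityʳ _) (length-reverse ds)) (sym (length-map proj₁ μ)) ⟩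
      length ds + length (map proj₁ μ)
        ≡⟨ length-unmatched increasing₁ ⟩
      n ∎
      where
      ds = unmatched (map proj₁ μ)
      is = unmatched (map proj₂ μ)

    #insertions-operations : #insertions (operations Y μ) + length μ ≡ n′
    #insertions-operations = begin
      #insertions (operations Y μ) + length μ
        ≡⟨ cong (_+ length μ) (#insertions-++ (deletions ds) _) ⟩
      #insertions (deletions {A = A} ds) + #insertions (insertions Y is) + length μ
        ≡⟨ cong (_+ length μ) (cong₂ _+_ (#insertions-deletions (reverse ds)) (#insertions-insertions Y is)) ⟩
      length is + length μ
        ≡⟨ cong (_+_ (length is)) (length-map proj₂ μ) ⟨
      length is + length (map proj₂ μ)
        ≡⟨ length-unmatched increasing₂ ⟩
      n′ ∎
      where
      ds = unmatched (map proj₁ μ)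
      is = unmatched (map proj₂ μ)

  run-operations : (X : Vec A n) (Y : Vec A n′) → (∀ {u v} → G u v → lookup X u ≡ lookup Y v) →
                   run (operations Y μ) (toList X) ≡ toList Y
  run-operations X Y G⇒≡ = begin
    run (operations Y μ) (toList X)
      ≡⟨ run-++ (deletions (unmatched us)) _ _ ⟩
    run (insertions Y (unmatched vs)) (run (deletions (unmatched us)) (toList X))
      ≡⟨ cong (run (insertions Y (unmatched vs))) middle ⟩
    run (insertions Y (unmatched vs)) (map (lookup Y) (filter (λ v → _∈?_ Fin._≟_ v vs) (allFin _)))
      ≡⟨ run-insertions Y (λ v → _∈?_ Fin._≟_ v vs) ⟩
    toList Y ∎
    where
    open ≡-Reasoning
    us = map proj₁ μ
    vs = map proj₂ μ

    equal : ∀ {ν : Matching n n′} → All (λ (u , v) → G u v) ν →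
            map (lookup X) (map proj₁ ν) ≡ map (lookup Y) (map proj₂ ν)
    equal []       = refl
    equal (e ∷ es) = cong₂ _∷_ (G⇒≡ e) (equal es)

    middle : run (deletions (unmatched us)) (toList X) ≡
             map (lookup Y) (filter (λ v → _∈?_ Fin._≟_ v vs) (allFin _))
    middle = begin
      run (deletions (unmatched us)) (toList X)
        ≡⟨ run-deletions X (λ u → _∈?_ Fin._≟_ u us) ⟩
      map (lookup X) (filter (λ u → _∈?_ Fin._≟_ u us) (allFin _))
        ≡⟨ cong (map (lookup X)) (filter-∈-allFin increasing₁) ⟩
      map (lookup X) us
        ≡⟨ equal (NonCrossing.edges nc) ⟩
      map (lookup Y) vs
        ≡⟨ cong (map (lookup Y)) (filter-∈-allFin increasing₂) ⟨
      map (lookup Y) (filter (λ v → _∈?_ Fin._≟_ v vs) (allFin _)) ∎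

-- Alignments as lattice paths

-- Lattice paths from (u , v) to (u′ , v′) with D horizontal or vertical and E
-- diagonal steps.
data Path (P : ℕ → ℕ → Set) : (u v u′ v′ D E : ℕ) → Set where
  done  : ∀ {u v} → Path P u v u v 0 0
  del   : ∀ {u v u′ v′ D E} → Path P (suc u) v u′ v′ D E → Path P u v u′ v′ (suc D) E
  ins   : ∀ {u v u′ v′ D E} → Path P u (suc v) u′ v′ D E → Path P u v u′ v′ (suc D) E
  match : ∀ {u v u′ v′ D E} → P u v → Path P (suc u) (suc v) u′ v′ D E → Path P u v u′ v′ D (suc E)

infixr 5 _◅◅_

_◅◅_ : Path P u v u′ v′ D E → Path P u′ v′ u″ v″ D′ E′ → Path P u v u″ v″ (D + D′) (E + E′)
done      ◅◅ β = β
del α     ◅◅ β = del (α ◅◅ β)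
ins α     ◅◅ β = ins (α ◅◅ β)
match p α ◅◅ β = match p (α ◅◅ β)

path-+ : Path P u v u′ v′ D E → D + 2 * E + (u + v) ≡ u′ + v′
path-+ done                          = refl
path-+ (del {u} {v} {D = D} {E} α)   = trans (lemma D E u v) (path-+ α)
  where
  lemma : ∀ D E u v → suc D + 2 * E + (u + v) ≡ D + 2 * E + (suc u + v)
  lemma = solve-∀
path-+ (ins {u} {v} {D = D} {E} α)   = trans (lemma D E u v) (path-+ α)
  where
  lemma : ∀ D E u v → suc D + 2 * E + (u + v) ≡ D + 2 * E + (u + suc v)
  lemma = solve-∀
path-+ (match {u} {v} {D = D} {E} _ α) = trans (lemma D E u v) (path-+ α)
  where
  lemma : ∀ D E u v → D + 2 * suc E + (u + v) ≡ D + 2 * E + (suc u + suc v)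
  lemma = solve-∀

path-≤₁ : Path P u v u′ v′ D E → E + u ≤ u′
path-≤₁ done        = ℕ.≤-refl
path-≤₁ (del α)     = ℕ.≤-trans (ℕ.+-monoʳ-≤ _ (ℕ.n≤1+n _)) (path-≤₁ α)
path-≤₁ (ins α)     = path-≤₁ α
path-≤₁ (match _ α) = ℕ.≤-trans (ℕ.≤-reflexive (sym (ℕ.+-suc _ _))) (path-≤₁ α)

path-≤₂ : Path P u v u′ v′ D E → E + v ≤ v′
path-≤₂ done        = ℕ.≤-refl
path-≤₂ (del α)     = path-≤₂ α
path-≤₂ (ins α)     = ℕ.≤-trans (ℕ.+-monoʳ-≤ _ (ℕ.n≤1+n _)) (path-≤₂ α)
path-≤₂ (match _ α) = ℕ.≤-trans (ℕ.≤-reflexive (sym (ℕ.+-suc _ _))) (path-≤₂ α)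

path-mono₁ : Path P u v u′ v′ D E → u ≤ u′
path-mono₁ α = ℕ.m+n≤o⇒n≤o _ (path-≤₁ α)

path-mono₂ : Path P u v u′ v′ D E → v ≤ v′
path-mono₂ α = ℕ.m+n≤o⇒n≤o _ (path-≤₂ α)

path-map : (α : Path P u v u′ v′ D E) →
           (∀ {x y} → u ≤ x → x < u′ → v ≤ y → y < v′ → P x y → Q x y) →
           Path Q u v u′ v′ D E
path-map done        f = done
path-map (del α)     f = del (path-map α λ u≤ → f (ℕ.≤-trans (ℕ.n≤1+n _) u≤))
path-map (ins α)     f = ins (path-map α λ u≤ u< v≤ → f u≤ u< (ℕ.≤-trans (ℕ.n≤1+n _) v≤))
path-map (match p α) f =
  match (f ℕ.≤-refl (path-mono₁ α) ℕ.≤-refl (path-mono₂ α) p)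
        (path-map α λ u≤ u< v≤ → f (ℕ.≤-trans (ℕ.n≤1+n _) u≤) u< (ℕ.≤-trans (ℕ.n≤1+n _) v≤))

straighten : Path P u v u′ v′ D E → Path Q u v u′ v′ (D + 2 * E) 0
straighten done        = done
straighten (del α)     = del (straighten α)
straighten (ins α)     = ins (straighten α)
straighten {Q = Q} (match {u} {v} {u′} {v′} {D} {E} _ α) =
  subst (λ d → Path Q u v u′ v′ d 0) (sym (lemma D E)) (del (ins (straighten α)))
  where
  lemma : ∀ D E → D + 2 * suc E ≡ suc (suc (D + 2 * E))
  lemma = solve-∀

record Split (P : ℕ → ℕ → Set) (u v x y u′ v′ D E : ℕ) : Set where
  constructor split
  field
    {D₁ E₁ D₂ E₂} : ℕ
    before : Path P u v x y D₁ E₁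
    after  : Path P x y u′ v′ D₂ E₂
    D₁+D₂  : D₁ + D₂ ≡ D
    E₁+E₂  : E₁ + E₂ ≡ E

open Split public

splitAt₁ : ∀ {x} → Path P u v u′ v′ D E → u ≤ x → x ≤ u′ → ∃ λ y → Split P u v x y u′ v′ D E
splitAt₁ {u = u} {x = x} α u≤x x≤u′ with u ℕ.≟ x
... | yes refl = _ , split done α refl refl
splitAt₁ done u≤x x≤u | no u≢x = contradiction (ℕ.≤-antisym u≤x x≤u) u≢x
splitAt₁ (del α) u≤x x≤u′ | no u≢x with _ , split β γ refl refl ← splitAt₁ α (ℕ.≤∧≢⇒< u≤x u≢x) x≤u′ =
  _ , split (del β) γ refl refl
splitAt₁ (ins α) u≤x x≤u′ | no u≢x with _ , split β γ refl refl ← splitAt₁ α u≤x x≤u′ =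
  _ , split (ins β) γ refl refl
splitAt₁ (match p α) u≤x x≤u′ | no u≢x with _ , split β γ refl refl ← splitAt₁ α (ℕ.≤∧≢⇒< u≤x u≢x) x≤u′ =
  _ , split (match p β) γ refl refl

splitAt₂ : ∀ {y} → Path P u v u′ v′ D E → v ≤ y → y ≤ v′ → ∃ λ x → Split P u v x y u′ v′ D E
splitAt₂ {v = v} {y = y} α v≤y y≤v′ with v ℕ.≟ y
... | yes refl = _ , split done α refl refl
splitAt₂ done v≤y y≤v | no v≢y = contradiction (ℕ.≤-antisym v≤y y≤v) v≢y
splitAt₂ (ins α) v≤y y≤v′ | no v≢y with _ , split β γ refl refl ← splitAt₂ α (ℕ.≤∧≢⇒< v≤y v≢y) y≤v′ =
  _ , split (ins β) γ refl refl
splitAt₂ (del α) v≤y y≤v′ | no v≢y with _ , split β γ refl refl ← splitAt₂ α v≤y y≤v′ =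
  _ , split (del β) γ refl refl
splitAt₂ (match p α) v≤y y≤v′ | no v≢y with _ , split β γ refl refl ← splitAt₂ α (ℕ.≤∧≢⇒< v≤y v≢y) y≤v′ =
  _ , split (match p β) γ refl refl

At : (a b : ℕ) → Graph n n′ → ℕ → ℕ → Set
At a b G u v = ∃₂ λ x y → a + toℕ x ≡ u × b + toℕ y ≡ v × G x y

module _ {a b : ℕ} {G : Graph n n′} where

  private
    toMatching : Path (At a b G) u v u′ v′ D E → ∃ λ (μ : Matching n n′) →
                 All (λ (x , y) → G x y) μ ×
                 AllPairs (λ (x , y) (x′ , y′) → x Fin.< x′ × y Fin.< y′) μ ×
                 length μ ≡ E ×
                 All (λ (x , y) → u ≤ a + toℕ x × v ≤ b + toℕ y) μ
    toMatching done = [] , [] , [] , refl , []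
    toMatching (del α) with μ , es , inc , len , ≥ ← toMatching α =
      μ , es , inc , len , All.map (λ (p , q) → ℕ.≤-trans (ℕ.n≤1+n _) p , q) ≥
    toMatching (ins α) with μ , es , inc , len , ≥ ← toMatching α =
      μ , es , inc , len , All.map (λ (p , q) → p , ℕ.≤-trans (ℕ.n≤1+n _) q) ≥
    toMatching (match (x , y , refl , refl , e) α) with μ , es , inc , len , ≥ ← toMatching α =
      (x , y) ∷ μ , e ∷ es ,
      All.map (λ (p , q) → ℕ.+-cancelˡ-< a _ _ p , ℕ.+-cancelˡ-< b _ _ q) ≥ ∷ inc ,
      cong suc len ,
      (ℕ.≤-refl , ℕ.≤-refl) ∷ All.map (λ (p , q) → ℕ.<⇒≤ p , ℕ.<⇒≤ q) ≥

  fromPath : Path (At a b G) u v u′ v′ D E → ∃ λ μ → NonCrossing G μ × length μ ≡ E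
  fromPath α with μ , es , inc , len , _ ← toMatching α =
    μ , record { edges = es ; sorted = AllPairs⇒Linked inc } , len

data Align {A : Set} : List A → List A → ℕ → Set where
  []    : Align [] [] 0
  del   : ∀ {x xs ys d} → Align xs ys d → Align (x ∷ xs) ys (suc d)
  ins   : ∀ {y xs ys d} → Align xs ys d → Align xs (y ∷ ys) (suc d)
  match : ∀ {x xs ys d} → Align xs ys d → Align (x ∷ xs) (x ∷ ys) d

align-refl : (xs : List A) → Align xs xs 0
align-refl []       = []
align-refl (x ∷ xs) = match (align-refl xs)

undo-delete : ∀ p {xs ys : List A} {d} → Align (apply (delete p) xs) ys d → ∃ λ d′ → d′ ≤ suc d × Align xs ys d′
undo-delete zero    {[]}     α = _ , ℕ.n≤1+n _ , α
undo-delete (suc p) {[]}     α = _ , ℕ.n≤1+n _ , α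
undo-delete zero    {x ∷ xs} α = _ , ℕ.≤-refl , del α
undo-delete (suc p) {x ∷ xs} (del α) with _ , ≤ , β ← undo-delete p {xs} α = _ , s≤s ≤ , del β
undo-delete (suc p) {x ∷ xs} (ins α) with _ , ≤ , β ← undo-delete (suc p) {x ∷ xs} α = _ , s≤s ≤ , ins β
undo-delete (suc p) {x ∷ xs} (match α) with _ , ≤ , β ← undo-delete p {xs} α = _ , ≤ , match β

undo-insert-here : ∀ {a} {xs ys : List A} {d} → Align (a ∷ xs) ys d → ∃ λ d′ → d′ ≤ suc d × Align xs ys d′
undo-insert-here (del α)   = _ , ℕ.≤-trans (ℕ.n≤1+n _) (ℕ.n≤1+n _) , α
undo-insert-here (match α) = _ , ℕ.≤-refl , ins α
undo-insert-here (ins α) with _ , ≤ , β ← undo-insert-here α = _ , s≤s ≤ , ins β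

undo-insert : ∀ p {a} {xs ys : List A} {d} → Align (apply (insert p a) xs) ys d → ∃ λ d′ → d′ ≤ suc d × Align xs ys d′
undo-insert zero    α = undo-insert-here α
undo-insert (suc p) {xs = []} α = undo-insert-here α
undo-insert (suc p) {xs = x ∷ xs} (del α) with _ , ≤ , β ← undo-insert p {xs = xs} α = _ , s≤s ≤ , del β
undo-insert (suc p) {xs = x ∷ xs} (ins α) with _ , ≤ , β ← undo-insert (suc p) {xs = x ∷ xs} α = _ , s≤s ≤ , ins β
undo-insert (suc p) {xs = x ∷ xs} (match α) with _ , ≤ , β ← undo-insert p {xs = xs} α = _ , ≤ , match β

align-run : (os : List (Op A)) (xs : List A) → ∃ λ d → d ≤ length os × Align xs (run os xs) d
align-run [] xs = 0 , z≤n , align-refl xs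
align-run (delete p ∷ os) xs with _ , d≤ , α ← align-run os (apply (delete p) xs)
  with _ , d′≤ , β ← undo-delete p α = _ , ℕ.≤-trans d′≤ (s≤s d≤) , β
align-run (insert p a ∷ os) xs with _ , d≤ , α ← align-run os (apply (insert p a) xs)
  with _ , d′≤ , β ← undo-insert p α = _ , ℕ.≤-trans d′≤ (s≤s d≤) , β

Same : Vec A n → Vec A n′ → Graph n n′
Same X Y u v = lookup X u ≡ lookup Y v

toPath : ∀ {d} (X : Vec A n) (Y : Vec A n′) {a b} →
         (∀ x y → Same X Y x y → P (toℕ x + a) (toℕ y + b)) →
         Align (toList X) (toList Y) d → ∃ λ E → Path P a b (n + a) (n′ + b) d E
toPath {P = P} X Y {a} {b} f α = go X Y f α
  where
  next₁ : ∀ {x} {X : Vec A n} {Y : Vec A n′} {a b} →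
          (∀ i j → Same (x ∷ X) Y i j → P (toℕ i + a) (toℕ j + b)) →
          ∀ i j → Same X Y i j → P (toℕ i + suc a) (toℕ j + b)
  next₁ {a = a} {b} f i j e = subst (λ u → P u (toℕ j + b)) (sym (ℕ.+-suc (toℕ i) a)) (f (suc i) j e)

  next₂ : ∀ {y} {X : Vec A n} {Y : Vec A n′} {a b} →
          (∀ i j → Same X (y ∷ Y) i j → P (toℕ i + a) (toℕ j + b)) →
          ∀ i j → Same X Y i j → P (toℕ i + a) (toℕ j + suc b)
  next₂ {a = a} {b} f i j e = subst (P (toℕ i + a)) (sym (ℕ.+-suc (toℕ j) b)) (f i (suc j) e)

  del′ : ∀ {k a b d} → ∃ (Path P (suc a) b (k + suc a) v′ d) → ∃ (Path P a b (suc k + a) v′ (suc d))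
  del′ {v′} {k} {a} {b} {d} (E , π) = E , del (subst (λ u → Path P (suc a) b u v′ d E) (ℕ.+-suc k a) π)

  ins′ : ∀ {k a b d} → ∃ (Path P a (suc b) u′ (k + suc b) d) → ∃ (Path P a b u′ (suc k + b) (suc d))
  ins′ {u′} {k} {a} {b} {d} (E , π) = E , ins (subst (λ v → Path P a (suc b) u′ v d E) (ℕ.+-suc k b) π)

  match′ : ∀ {k l a b d} → P a b → ∃ (Path P (suc a) (suc b) (k + suc a) (l + suc b) d) →
           ∃ (Path P a b (suc k + a) (suc l + b) d)
  match′ {k} {l} {a} {b} {d} p (E , π) =
    suc E , match p (subst₂ (λ u v → Path P (suc a) (suc b) u v d E) (ℕ.+-suc k a) (ℕ.+-suc l b) π)

  go : ∀ {d} (X : Vec A n) (Y : Vec A n′) {a b} →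
       (∀ x y → Same X Y x y → P (toℕ x + a) (toℕ y + b)) →
       Align (toList X) (toList Y) d → ∃ λ E → Path P a b (n + a) (n′ + b) d E
  go []      []      f []      = 0 , done
  go (x ∷ X) []      f (del α) = del′ (go X [] (next₁ {x = x} {X} {[]} f) α)
  go (x ∷ X) (y ∷ Y) f (del α) = del′ (go X (y ∷ Y) (next₁ {x = x} {X} {y ∷ Y} f) α)
  go []      (y ∷ Y) f (ins α) = ins′ (go [] Y (next₂ {y = y} {[]} {Y} f) α)
  go (x ∷ X) (y ∷ Y) f (ins α) = ins′ (go (x ∷ X) Y (next₂ {y = y} {x ∷ X} {Y} f) α)
  go (x ∷ X) (x ∷ Y) f (match α) =
    match′ (f zero zero refl) (go X Y (next₂ {y = x} {X} {Y} (next₁ {x = x} {X} {x ∷ Y} f)) α)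

run⇒path : (X : Vec A n) (Y : Vec A n′) (os : List (Op A)) → run os (toList X) ≡ toList Y →
           ∃₂ λ D E → D ≤ length os × Path (At 0 0 (Same X Y)) 0 0 n n′ D E
run⇒path {n = n} {n′ = n′} X Y os eq with d , d≤ , α ← align-run os (toList X)
  with E , π ← toPath {P = At 0 0 (Same X Y)} X Y {0} {0}
                 (λ x y e → x , y , sym (ℕ.+-identityʳ (toℕ x)) , sym (ℕ.+-identityʳ (toℕ y)) , e)
                 (subst (λ ys → Align (toList X) ys d) eq α) =
  d , E , d≤ , subst₂ (λ u v → Path (At 0 0 (Same X Y)) 0 0 u v d E) (ℕ.+-identityʳ n) (ℕ.+-identityʳ n′) π

-- Unmatching the pieces without a heavy block

-- ε = e / f
module Refinement (e f : ℕ) (0<e : 0 < e) (121e≤f : 121 * e ≤ f) where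

  record HeavyBlock (P : ℕ → ℕ → Set) (N c u v u′ v′ : ℕ) : Set where
    field
      {u₁ v₁ u₂ v₂ d k} : ℕ
      path  : Path P u₁ v₁ u₂ v₂ d k
      cN≤u₁ : c * N ≤ u₁
      u₂≤   : u₂ ≤ suc c * N
      u≤u₁  : u ≤ u₁
      u₂≤u′ : u₂ ≤ u′
      v≤v₁  : v ≤ v₁
      v₂≤v′ : v₂ ≤ v′
      heavy : e * N ≤ f * k

  ∃heavy⊎light : ∀ N a T → Path P u v u′ v′ D E →
                 a * N ≤ u → u ≤ suc a * N → u′ ≤ (a + T) * N →
                 (∃ λ c → a ≤ c × c < a + T × HeavyBlock P N c u v u′ v′) ⊎ f * E ≤ T * (e * N)
  ∃heavy⊎light {u = u} {u′ = u′} {E = E} N a zero α aN≤u _ u′≤ = inj₂ (begin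
    f * E ≡⟨ cong (f *_) E≡0 ⟩
    f * 0 ≡⟨ ℕ.*-zeroʳ f ⟩
    0     ∎)
    where
    open ℕ.≤-Reasoning
    E≡0 : E ≡ 0
    E≡0 = ℕ.n≤0⇒n≡0 (ℕ.+-cancelʳ-≤ u E 0 (begin
      E + u       ≤⟨ path-≤₁ α ⟩
      u′          ≤⟨ u′≤ ⟩
      (a + 0) * N ≡⟨ cong (_* N) (ℕ.+-identityʳ a) ⟩
      a * N       ≤⟨ aN≤u ⟩
      u           ∎))
  ∃heavy⊎light {u′ = u′} {E = E} N a (suc T) α aN≤u u≤ u′≤ with u′ ℕ.≤? suc a * N
  ... | yes u′≤[1+a]N with e * N ℕ.≤? f * E
  ...   | yes eN≤fE = inj₁ (a , ℕ.≤-refl , ℕ.m<m+n a ℕ.z<s , record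
    { path = α ; cN≤u₁ = aN≤u ; u₂≤ = u′≤[1+a]N ; u≤u₁ = ℕ.≤-refl ; u₂≤u′ = ℕ.≤-refl
    ; v≤v₁ = ℕ.≤-refl ; v₂≤v′ = ℕ.≤-refl ; heavy = eN≤fE })
  ...   | no  eN≰fE = inj₂ (ℕ.≤-trans (ℕ.<⇒≤ (ℕ.≰⇒> eN≰fE)) (ℕ.m≤m+n (e * N) _))
  ∃heavy⊎light {u′ = u′} {E = E} N a (suc T) α aN≤u u≤ u′≤ | no u′≰
    with _ , split {E₁ = E₁} {E₂ = E₂} β γ refl refl ← splitAt₁ α u≤ (ℕ.<⇒≤ (ℕ.≰⇒> u′≰)) with e * N ℕ.≤? f * E₁
  ...   | yes eN≤fE = inj₁ (a , ℕ.≤-refl , ℕ.m<m+n a ℕ.z<s , record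
    { path = β ; cN≤u₁ = aN≤u ; u₂≤ = ℕ.≤-refl ; u≤u₁ = ℕ.≤-refl ; u₂≤u′ = path-mono₁ γ
    ; v≤v₁ = ℕ.≤-refl ; v₂≤v′ = path-mono₂ γ ; heavy = eN≤fE })
  ...   | no  eN≰fE with ∃heavy⊎light N (suc a) T γ ℕ.≤-refl (ℕ.m≤n+m _ N)
                           (ℕ.≤-trans u′≤ (ℕ.≤-reflexive (cong (_* N) (ℕ.+-suc a T))))
  ...     | inj₁ (c , a<c , c< , h) = inj₁ (c , ℕ.<⇒≤ a<c , ℕ.≤-trans c< (ℕ.≤-reflexive (sym (ℕ.+-suc a T))) , record
    { path = path ; cN≤u₁ = cN≤u₁ ; u₂≤ = u₂≤ ; u≤u₁ = ℕ.≤-trans (path-mono₁ β) u≤u₁ ; u₂≤u′ = u₂≤u′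
    ; v≤v₁ = ℕ.≤-trans (path-mono₂ β) v≤v₁ ; v₂≤v′ = v₂≤v′ ; heavy = heavy })
    where open HeavyBlock h
  ...     | inj₂ light = inj₂ (begin
    f * (E₁ + E₂)           ≡⟨ ℕ.*-distribˡ-+ f E₁ E₂ ⟩
    f * E₁ + f * E₂         ≤⟨ ℕ.+-mono-≤ (ℕ.<⇒≤ (ℕ.≰⇒> eN≰fE)) light ⟩
    e * N + T * (e * N)     ∎)
    where open ℕ.≤-Reasoning

  -- The path spans the blocks a , … , a + t of length N of the first string,
  -- where t ≤ 1 / ε, and block c among them is heavy.
  record Good (P : ℕ → ℕ → Set) (N u v u′ v′ : ℕ) : Set where
    field
      t a c : ℕ
      te≤f  : t * e ≤ f
      0<N   : 0 < N
      aN≤u  : a * N ≤ u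
      u′≤   : u′ ≤ suc (a + t) * N
      a≤c   : a ≤ c
      c≤a+t : c ≤ a + t
      block : HeavyBlock P N c u v u′ v′
    open HeavyBlock block public

    u₁<u₂ : u₁ < u₂
    u₁<u₂ with k | path | heavy
    ... | zero  | _ | eN≤f0 = contradiction (ℕ.≤-trans (ℕ.*-mono-≤ 0<e 0<N) (ℕ.≤-trans eN≤f0 (ℕ.≤-reflexive (ℕ.*-zeroʳ f)))) λ ()
    ... | suc _ | α | _     = ℕ.m+n≤o⇒n≤o _ (ℕ.≤-trans (ℕ.≤-reflexive (ℕ.+-suc _ u₁)) (path-≤₁ α))

  Cheap : (D D′ : ℕ) → Set
  Cheap D D′ = f * D′ ≤ (f + 23 * e) * D

  arithmetic : ∀ {x y z} → x ≤ 2 * y + 3 * z → 121 * z ≤ x → 2 * x ≤ 23 * y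
  arithmetic {x} {y} {z} x≤ 121z≤x = ℕ.*-cancelˡ-≤ 118 (begin
    118 * (2 * x)  ≡⟨ lemma₁ x ⟩
    2 * (118 * x)  ≤⟨ ℕ.*-monoʳ-≤ 2 118x≤242y ⟩
    2 * (242 * y)  ≡⟨ ℕ.*-assoc 2 242 y ⟨
    484 * y        ≤⟨ ℕ.*-monoˡ-≤ y (ℕ.m≤m+n 484 2230) ⟩
    2714 * y       ≡⟨ ℕ.*-assoc 118 23 y ⟩
    118 * (23 * y) ∎)
    where
    open ℕ.≤-Reasoning
    lemma₁ : ∀ x → 118 * (2 * x) ≡ 2 * (118 * x)
    lemma₁ = solve-∀
    lemma₂ : ∀ x → 118 * x + 3 * x ≡ 121 * x
    lemma₂ = solve-∀
    lemma₃ : ∀ y z → 121 * (2 * y + 3 * z) ≡ 242 * y + 3 * (121 * z)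
    lemma₃ = solve-∀
    118x≤242y : 118 * x ≤ 242 * y
    118x≤242y = ℕ.+-cancelʳ-≤ (3 * x) _ _ (begin
      118 * x + 3 * x         ≡⟨ lemma₂ x ⟩
      121 * x                 ≤⟨ ℕ.*-monoʳ-≤ 121 x≤ ⟩
      121 * (2 * y + 3 * z)   ≡⟨ lemma₃ y z ⟩
      242 * y + 3 * (121 * z) ≤⟨ ℕ.+-monoʳ-≤ (242 * y) (ℕ.*-monoʳ-≤ 3 121z≤x) ⟩
      242 * y + 3 * x         ∎)

  cheap : ∀ {T N} → f * E ≤ T * (e * N) → T * N ≤ 2 * D + 3 * E → Cheap D (D + 2 * E)
  cheap {E} {D} {T} {N} fE≤ TN≤ = begin
    f * (D + 2 * E)          ≡⟨ lemma₁ f D E ⟩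
    f * D + 2 * (f * E)      ≤⟨ ℕ.+-monoʳ-≤ (f * D) (arithmetic {y = e * D} {z = e * E} fE≤′ 121eE≤fE) ⟩
    f * D + 23 * (e * D)     ≡⟨ lemma₂ f e D ⟩
    (f + 23 * e) * D         ∎
    where
    open ℕ.≤-Reasoning
    lemma₁ : ∀ f D E → f * (D + 2 * E) ≡ f * D + 2 * (f * E)
    lemma₁ = solve-∀
    lemma₂ : ∀ f e D → f * D + 23 * (e * D) ≡ (f + 23 * e) * D
    lemma₂ = solve-∀
    lemma₃ : ∀ T e N → T * (e * N) ≡ e * (T * N)
    lemma₃ = solve-∀
    lemma₄ : ∀ e D E → e * (2 * D + 3 * E) ≡ 2 * (e * D) + 3 * (e * E)
    lemma₄ = solve-∀
    fE≤′ : f * E ≤ 2 * (e * D) + 3 * (e * E)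
    fE≤′ = begin
      f * E                       ≤⟨ fE≤ ⟩
      T * (e * N)                 ≡⟨ lemma₃ T e N ⟩
      e * (T * N)                 ≤⟨ ℕ.*-monoʳ-≤ e TN≤ ⟩
      e * (2 * D + 3 * E)         ≡⟨ lemma₄ e D E ⟩
      2 * (e * D) + 3 * (e * E)   ∎
    121eE≤fE : 121 * (e * E) ≤ f * E
    121eE≤fE = begin
      121 * (e * E) ≡⟨ ℕ.*-assoc 121 e E ⟨
      121 * e * E   ≤⟨ ℕ.*-monoˡ-≤ E 121e≤f ⟩
      f * E         ∎

  good⊎cheap : ∀ N → v′ ≡ v + N → Path P u v u′ v′ D E → Good P N u v u′ v′ ⊎ Cheap D (D + 2 * E)
  good⊎cheap {v = v} {D = D} {E} zero refl α = inj₂ (cheap {T = 0} {0} fE≤0 z≤n)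
    where
    E≡0 : E ≡ 0
    E≡0 = ℕ.n≤0⇒n≡0 (ℕ.+-cancelʳ-≤ v E 0 (ℕ.≤-trans (path-≤₂ α) (ℕ.≤-reflexive (ℕ.+-identityʳ v))))
    fE≤0 : f * E ≤ 0
    fE≤0 = ℕ.≤-reflexive (trans (cong (f *_) E≡0) (ℕ.*-zeroʳ f))
  good⊎cheap {v = v} {P = P} {u = u} {u′ = u′} {D} {E} N@(suc _) refl α =
    conclude (∃heavy⊎light N a (suc t) α aN≤u u≤
      (ℕ.≤-trans u′≤ (ℕ.≤-reflexive (cong (_* N) (sym (ℕ.+-suc a t))))))
    where
    open ℕ.≤-Reasoning
    a = u ℕ./ N
    b = u′ ℕ./ N
    t = b ∸ a

    below : ∀ x → x ≤ suc (x ℕ./ N) * N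
    below x = begin
      x                           ≡⟨ ℕ.m≡m%n+[m/n]*n x N ⟩
      x ℕ.% N + (x ℕ./ N) * N     ≤⟨ ℕ.+-monoˡ-≤ _ (ℕ.<⇒≤ (ℕ.m%n<n x N)) ⟩
      suc (x ℕ./ N) * N           ∎

    aN≤u : a * N ≤ u
    aN≤u = ℕ.m/n*n≤m u N
    u≤ : u ≤ suc a * N
    u≤ = below u
    a+t≡b : a + t ≡ b
    a+t≡b = ℕ.m+[n∸m]≡n (ℕ./-monoˡ-≤ N (path-mono₁ α))
    u′≤ : u′ ≤ suc (a + t) * N
    u′≤ = ℕ.≤-trans (below u′) (ℕ.≤-reflexive (cong (λ x → suc x * N) (sym a+t≡b)))

    length≡ : D + 2 * E + u ≡ u′ + N
    length≡ = ℕ.+-cancelʳ-≡ v _ _ (trans (ℕ.+-assoc (D + 2 * E) u v) (trans (path-+ α) (lemma u′ v N)))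
      where
      lemma : ∀ u v N → u + (v + N) ≡ u + N + v
      lemma = solve-∀

    tN≤ : t * N ≤ D + 2 * E
    tN≤ = ℕ.+-cancelʳ-≤ (suc a * N) _ _ (begin
      t * N + suc a * N     ≡⟨ lemma t a N ⟩
      (a + t) * N + N       ≡⟨ cong (λ x → x * N + N) a+t≡b ⟩
      b * N + N             ≤⟨ ℕ.+-monoˡ-≤ N (ℕ.m/n*n≤m u′ N) ⟩
      u′ + N                ≡⟨ length≡ ⟨
      D + 2 * E + u         ≤⟨ ℕ.+-monoʳ-≤ (D + 2 * E) u≤ ⟩
      D + 2 * E + suc a * N ∎)
      where
      lemma : ∀ t a N → t * N + suc a * N ≡ (a + t) * N + N
      lemma = solve-∀

    N≤ : N ≤ D + E
    N≤ = ℕ.+-cancelʳ-≤ (E + u) _ _ (begin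
      N + (E + u)     ≤⟨ ℕ.+-monoʳ-≤ N (path-≤₁ α) ⟩
      N + u′          ≡⟨ ℕ.+-comm N u′ ⟩
      u′ + N          ≡⟨ length≡ ⟨
      D + 2 * E + u   ≡⟨ lemma D E u ⟩
      D + E + (E + u) ∎)
      where
      lemma : ∀ D E u → D + 2 * E + u ≡ D + E + (E + u)
      lemma = solve-∀

    TN≤ : suc t * N ≤ 2 * D + 3 * E
    TN≤ = ℕ.≤-trans (ℕ.+-mono-≤ N≤ tN≤) (ℕ.≤-reflexive (lemma D E))
      where
      lemma : ∀ D E → D + E + (D + 2 * E) ≡ 2 * D + 3 * E
      lemma = solve-∀

    E≤N : E ≤ N
    E≤N = ℕ.+-cancelʳ-≤ v E N (ℕ.≤-trans (path-≤₂ α) (ℕ.≤-reflexive (ℕ.+-comm v N)))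

    conclude : (∃ λ c → a ≤ c × c < a + suc t × HeavyBlock P N c u v u′ (v + N)) ⊎ f * E ≤ suc t * (e * N) →
               Good P N u v u′ (v + N) ⊎ Cheap D (D + 2 * E)
    conclude (inj₂ light) = inj₂ (cheap {T = suc t} {N} light TN≤)
    conclude (inj₁ (c , a≤c , c< , h)) with t * e ℕ.≤? f
    ... | yes te≤f = inj₁ (record
      { te≤f = te≤f ; 0<N = ℕ.z<s ; aN≤u = aN≤u ; u′≤ = u′≤ ; a≤c = a≤c
      ; c≤a+t = ℕ.≤-pred (ℕ.≤-trans c< (ℕ.≤-reflexive (ℕ.+-suc a t))) ; block = h })
    ... | no  te≰f = inj₂ (cheap {T = suc t} {N} (begin
      f * E             ≤⟨ ℕ.*-mono-≤ (ℕ.<⇒≤ (ℕ.≰⇒> te≰f)) E≤N ⟩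
      t * e * N         ≤⟨ ℕ.*-monoˡ-≤ N (ℕ.m≤n+m (t * e) e) ⟩
      suc t * e * N     ≡⟨ ℕ.*-assoc (suc t) e N ⟩
      suc t * (e * N)   ∎) TN≤)

  record Refined (Q : ℕ → ℕ → Set) (u v u′ v′ D : ℕ) : Set where
    constructor refined
    field
      {d k} : ℕ
      path    : Path Q u v u′ v′ d k
      isCheap : Cheap D d

  kept : Path Q u v u′ v′ D E → Refined Q u v u′ v′ D
  kept {D = D} α = refined α (ℕ.*-monoˡ-≤ D (ℕ.m≤m+n f (23 * e)))

  refine-blocks : ∀ N m →
    (∀ {p q D E} (i : Fin m) → u ≤ p → q ≤ u′ → Path P p (v + toℕ i * N) q (v + suc (toℕ i) * N) D E →
      Refined Q p (v + toℕ i * N) q (v + suc (toℕ i) * N) D) →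
    Path P u v u′ (v + m * N) D E → Refined Q u v u′ (v + m * N) D
  refine-blocks {u = u} {u′} {P} {v} {Q} {D} {E} N m h α =
    subst (λ y → Refined Q u y u′ (v + m * N) D) (ℕ.+-identityʳ v)
      (go m 0 refl ℕ.≤-refl (subst (λ y → Path P u y u′ (v + m * N) D E) (sym (ℕ.+-identityʳ v)) α))
    where
    step : ∀ i k → i + suc k ≡ m → suc i + k ≡ m
    step i k i+k≡m = trans (sym (ℕ.+-suc i k)) i+k≡m

    i<m : ∀ i k → i + suc k ≡ m → i < m
    i<m i k i+k≡m = ℕ.m+n≤o⇒m≤o (suc i) (ℕ.≤-reflexive (step i k i+k≡m))

    go : ∀ {p D E} k i → i + k ≡ m → u ≤ p → Path P p (v + i * N) u′ (v + m * N) D E →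
         Refined Q p (v + i * N) u′ (v + m * N) D
    go zero i i+0≡m _ α rewrite trans (sym i+0≡m) (ℕ.+-identityʳ i) =
      kept (path-map α λ _ _ y≥ y< → contradiction y≥ (ℕ.<⇒≱ y<))
    go (suc k) i i+k≡m u≤p α
      with x , split {D₁} {_} {D₂} β γ refl refl ← splitAt₂ α (ℕ.+-monoʳ-≤ v (ℕ.m≤n+m (i * N) N))
                                                     (ℕ.+-monoʳ-≤ v (ℕ.*-monoˡ-≤ N (i<m i k i+k≡m)))
      with refined {d} π c ← subst (λ i → ∀ {p q D E} → u ≤ p → q ≤ u′ →
                                      Path P p (v + i * N) q (v + suc i * N) D E →
                                      Refined Q p (v + i * N) q (v + suc i * N) D)
                               (Fin.toℕ-fromℕ< (i<m i k i+k≡m)) (h (Fin.fromℕ< (i<m i k i+k≡m))) u≤p (path-mono₁ γ) β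
         | refined {d′} ρ c′ ← go k (suc i) (step i k i+k≡m) (ℕ.≤-trans u≤p (path-mono₁ β)) γ =
      refined (π ◅◅ ρ) (begin
        f * (d + d′)                              ≡⟨ ℕ.*-distribˡ-+ f d d′ ⟩
        f * d + f * d′                            ≤⟨ ℕ.+-mono-≤ c c′ ⟩
        (f + 23 * e) * D₁ + (f + 23 * e) * D₂     ≡⟨ ℕ.*-distribˡ-+ (f + 23 * e) D₁ D₂ ⟨
        (f + 23 * e) * (D₁ + D₂)                  ∎)
      where open ℕ.≤-Reasoning

-- The rational parameter

fromℤ-≃ : ∀ z → toℚᵘ (fromℤ z) ≃ mkℚᵘ z 0
fromℤ-≃ z = ℚ.toℚᵘ-fromℚᵘ (mkℚᵘ z 0)

fromℤ-+ : ∀ a b → fromℤ (a ℤ.+ b) ≡ fromℤ a ℚ.+ fromℤ b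
fromℤ-+ a b = ℚ.toℚᵘ-injective (begin
  toℚᵘ (fromℤ (a ℤ.+ b))             ≈⟨ fromℤ-≃ (a ℤ.+ b) ⟩
  mkℚᵘ (a ℤ.+ b) 0                   ≡⟨ cong₂ (λ x y → mkℚᵘ (x ℤ.+ y) 0) (ℤ.*-identityʳ a) (ℤ.*-identityʳ b) ⟨
  mkℚᵘ a 0 ℚᵘ.+ mkℚᵘ b 0             ≈⟨ ℚᵘ.+-cong (fromℤ-≃ a) (fromℤ-≃ b) ⟨
  toℚᵘ (fromℤ a) ℚᵘ.+ toℚᵘ (fromℤ b) ≈⟨ ℚ.toℚᵘ-homo-+ (fromℤ a) (fromℤ b) ⟨
  toℚᵘ (fromℤ a ℚ.+ fromℤ b)         ∎)
  where open ℚᵘ.≃-Reasoning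

fromℤ-* : ∀ a b → fromℤ (a ℤ.* b) ≡ fromℤ a ℚ.* fromℤ b
fromℤ-* a b = ℚ.toℚᵘ-injective (begin
  toℚᵘ (fromℤ (a ℤ.* b))             ≈⟨ fromℤ-≃ (a ℤ.* b) ⟩
  mkℚᵘ a 0 ℚᵘ.* mkℚᵘ b 0             ≈⟨ ℚᵘ.*-cong (fromℤ-≃ a) (fromℤ-≃ b) ⟨
  toℚᵘ (fromℤ a) ℚᵘ.* toℚᵘ (fromℤ b) ≈⟨ ℚ.toℚᵘ-homo-* (fromℤ a) (fromℤ b) ⟨
  toℚᵘ (fromℤ a ℚ.* fromℤ b)         ∎)
  where open ℚᵘ.≃-Reasoning

fromℤ-mono-≤ : ∀ {a b} → a ℤ.≤ b → fromℤ a ℚ.≤ fromℤ b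
fromℤ-mono-≤ {a} {b} a≤b = ℚ.toℚᵘ-cancel-≤ (begin
  toℚᵘ (fromℤ a) ≃⟨ fromℤ-≃ a ⟩
  mkℚᵘ a 0       ≤⟨ ℚᵘ.*≤* (ℤ.*-monoʳ-≤-nonNeg (+ 1) a≤b) ⟩
  mkℚᵘ b 0       ≃⟨ fromℤ-≃ b ⟨
  toℚᵘ (fromℤ b) ∎)
  where open ℚᵘ.≤-Reasoning

fromℤ-mono-< : ∀ {a b} → a ℤ.< b → fromℤ a ℚ.< fromℤ b
fromℤ-mono-< {a} {b} a<b = ℚ.toℚᵘ-cancel-< (begin-strict
  toℚᵘ (fromℤ a) ≃⟨ fromℤ-≃ a ⟩
  mkℚᵘ a 0       <⟨ ℚᵘ.*<* (ℤ.*-monoʳ-<-pos (+ 1) a<b) ⟩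
  mkℚᵘ b 0       ≃⟨ fromℤ-≃ b ⟨
  toℚᵘ (fromℤ b) ∎)
  where open ℚᵘ.≤-Reasoning

fromℕ-* : ∀ a b → fromℕ (a * b) ≡ fromℕ a ℚ.* fromℕ b
fromℕ-* a b = trans (cong fromℤ (ℤ.pos-* a b)) (fromℤ-* (+ a) (+ b))

fromℕ-mono-≤ : ∀ {a b} → a ≤ b → fromℕ a ℚ.≤ fromℕ b
fromℕ-mono-≤ a≤b = fromℤ-mono-≤ (+≤+ a≤b)

inWindow : ∀ {w t c z} → fromℕ t ℚ.≤ w → c ℤ.≤ z ℤ.+ + t → z ℤ.≤ c ℤ.+ + t → InWindow w c z
inWindow {w} {t} {c} {z} t≤w c≤ z≤ = lower , upper
  where
  open ℚ.≤-Reasoning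
  lower : fromℤ c ℚ.- w ℚ.≤ fromℤ z
  lower = begin
    fromℤ c ℚ.- w             ≤⟨ ℚ.+-monoˡ-≤ (ℚ.- w) (fromℤ-mono-≤ c≤) ⟩
    fromℤ (z ℤ.+ + t) ℚ.- w   ≡⟨ cong (ℚ._- w) (fromℤ-+ z (+ t)) ⟩
    fromℤ z ℚ.+ fromℕ t ℚ.- w ≤⟨ ℚ.+-monoˡ-≤ (ℚ.- w) (ℚ.+-monoʳ-≤ (fromℤ z) t≤w) ⟩
    fromℤ z ℚ.+ w ℚ.- w       ≡⟨ ℚ.+-assoc (fromℤ z) w (ℚ.- w) ⟩
    fromℤ z ℚ.+ (w ℚ.- w)     ≡⟨ cong (ℚ._+_ (fromℤ z)) (ℚ.+-inverseʳ w) ⟩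
    fromℤ z ℚ.+ 0ℚ            ≡⟨ ℚ.+-identityʳ (fromℤ z) ⟩
    fromℤ z                   ∎
  upper : fromℤ z ℚ.≤ fromℤ c ℚ.+ w
  upper = begin
    fromℤ z             ≤⟨ fromℤ-mono-≤ z≤ ⟩
    fromℤ (c ℤ.+ + t)   ≡⟨ fromℤ-+ c (+ t) ⟩
    fromℤ c ℚ.+ fromℕ t ≤⟨ ℚ.+-monoʳ-≤ (fromℤ c) t≤w ⟩
    fromℤ c ℚ.+ w       ∎

record IsFraction (ε : ℚ) (e f : ℕ) : Set where
  constructor isFraction
  field
    f>0  : 0 < f
    fε≡e : fromℕ f ℚ.* ε ≡ fromℕ e

fraction : ∀ ε → 0ℚ ℚ.< ε → ε ℚ.< + 1 / 121 → IsFraction ε ℤ.∣ ↥ ε ∣ (↧ₙ ε) × 0 < ℤ.∣ ↥ ε ∣ × 121 * ℤ.∣ ↥ ε ∣ ≤ ↧ₙ ε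
fraction (mkℚ (+ zero) _ _)   (*<* (+<+ ()))
fraction (mkℚ (ℤ.-[1+ _ ]) _ _) (*<* ())
fraction ε@(mkℚ (+ e@(suc _)) f-1 _) _ (*<* (+<+ e*121<f)) =
  isFraction ℕ.z<s (ℚ.toℚᵘ-injective (begin
    toℚᵘ (fromℕ (suc f-1) ℚ.* ε)               ≈⟨ ℚ.toℚᵘ-homo-* (fromℕ (suc f-1)) ε ⟩
    toℚᵘ (fromℕ (suc f-1)) ℚᵘ.* mkℚᵘ (+ e) f-1 ≈⟨ ℚᵘ.*-cong (fromℤ-≃ (+ suc f-1)) (ℚᵘ.≃-refl {mkℚᵘ (+ e) f-1}) ⟩
    mkℚᵘ (+ suc f-1) 0 ℚᵘ.* mkℚᵘ (+ e) f-1     ≈⟨ *≡* (lemma (+ suc f-1) (+ e)) ⟩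
    mkℚᵘ (+ e) 0                               ≈⟨ fromℤ-≃ (+ e) ⟨
    toℚᵘ (fromℕ e)                             ∎)) ,
  ℕ.z<s ,
  ℕ.<⇒≤ (subst₂ _<_ (ℕ.*-comm e 121) (ℕ.+-identityʳ (suc f-1)) e*121<f)
  where
  open ℚᵘ.≃-Reasoning
  lemma : ∀ f e → f ℤ.* e ℤ.* + 1 ≡ e ℤ.* (+ 1 ℤ.* f)
  lemma f e = trans (ℤ.*-identityʳ (f ℤ.* e)) (trans (ℤ.*-comm f e) (cong (e ℤ.*_) (sym (ℤ.*-identityˡ f))))

module _ {ε e f} (ε≡e/f : IsFraction ε e f) where
  open IsFraction ε≡e/f
  open ℚ.≤-Reasoning
  open +-*-Solver using (solve; _:=_; _:+_; _:*_; _:-_; con)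

  private
    cancel : ∀ {p q} → fromℕ f ℚ.* p ℚ.≤ fromℕ f ℚ.* q → p ℚ.≤ q
    cancel = ℚ.*-cancelˡ-≤-pos (fromℕ f) {{positive (fromℤ-mono-< (+<+ f>0))}}

  fromℕ≤1/ε : (0<ε : 0ℚ ℚ.< ε) → ∀ t → t * e ≤ f → fromℕ t ℚ.≤ 1/_ ε {{ℚ.>-nonZero 0<ε}}
  fromℕ≤1/ε 0<ε t te≤f = ℚ.*-cancelʳ-≤-pos ε {{positive 0<ε}} (begin
    fromℕ t ℚ.* ε                   ≤⟨ cancel scaled ⟩
    1ℚ                              ≡⟨ ℚ.*-inverseˡ ε {{ℚ.>-nonZero 0<ε}} ⟨
    1/_ ε {{ℚ.>-nonZero 0<ε}} ℚ.* ε ∎)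
    where
    scaled : fromℕ f ℚ.* (fromℕ t ℚ.* ε) ℚ.≤ fromℕ f ℚ.* 1ℚ
    scaled = begin
      fromℕ f ℚ.* (fromℕ t ℚ.* ε) ≡⟨ solve 3 (λ f t ε → f :* (t :* ε) := t :* (f :* ε)) refl (fromℕ f) (fromℕ t) ε ⟩
      fromℕ t ℚ.* (fromℕ f ℚ.* ε) ≡⟨ cong (ℚ._*_ (fromℕ t)) fε≡e ⟩
      fromℕ t ℚ.* fromℕ e         ≡⟨ fromℕ-* t e ⟨
      fromℕ (t * e)               ≤⟨ fromℕ-mono-≤ te≤f ⟩
      fromℕ f                     ≡⟨ ℚ.*-identityʳ (fromℕ f) ⟨
      fromℕ f ℚ.* 1ℚ              ∎

  fromℕ≤N[1-ε] : ∀ {N E k} → k + E ≡ N → e * N ≤ f * E → fromℕ k ℚ.≤ fromℕ N ℚ.* (1ℚ ℚ.- ε)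
  fromℕ≤N[1-ε] {N} {E} {k} k+E≡N eN≤fE = cancel (begin
    fromℕ f ℚ.* fromℕ k
      ≡⟨ solve 3 (λ f k x → f :* k := f :* k :+ x :- x) refl (fromℕ f) (fromℕ k) (fromℕ e ℚ.* fromℕ N) ⟩
    fromℕ f ℚ.* fromℕ k ℚ.+ fromℕ e ℚ.* fromℕ N ℚ.- fromℕ e ℚ.* fromℕ N
      ≤⟨ ℚ.+-monoˡ-≤ (ℚ.- (fromℕ e ℚ.* fromℕ N)) scaled ⟩
    fromℕ f ℚ.* fromℕ N ℚ.- fromℕ e ℚ.* fromℕ N
      ≡⟨ cong (λ x → fromℕ f ℚ.* fromℕ N ℚ.- x ℚ.* fromℕ N) fε≡e ⟨
    fromℕ f ℚ.* fromℕ N ℚ.- fromℕ f ℚ.* ε ℚ.* fromℕ N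
      ≡⟨ solve 3 (λ f N ε → f :* N :- f :* ε :* N := f :* (N :* (con 1ℚ :- ε))) refl (fromℕ f) (fromℕ N) ε ⟩
    fromℕ f ℚ.* (fromℕ N ℚ.* (1ℚ ℚ.- ε)) ∎)
    where
    scaled : fromℕ f ℚ.* fromℕ k ℚ.+ fromℕ e ℚ.* fromℕ N ℚ.≤ fromℕ f ℚ.* fromℕ N
    scaled = begin
      fromℕ f ℚ.* fromℕ k ℚ.+ fromℕ e ℚ.* fromℕ N ≡⟨ cong₂ ℚ._+_ (fromℕ-* f k) (fromℕ-* e N) ⟨
      fromℕ (f * k) ℚ.+ fromℕ (e * N)             ≡⟨ fromℤ-+ (+ (f * k)) (+ (e * N)) ⟨
      fromℕ (f * k + e * N)                       ≤⟨ fromℕ-mono-≤ (ℕ.+-monoʳ-≤ (f * k) eN≤fE) ⟩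
      fromℕ (f * k + f * E)                       ≡⟨ cong fromℕ (ℕ.*-distribˡ-+ f k E) ⟨
      fromℕ (f * (k + E))                         ≡⟨ cong (λ x → fromℕ (f * x)) k+E≡N ⟩
      fromℕ (f * N)                               ≡⟨ fromℕ-* f N ⟩
      fromℕ f ℚ.* fromℕ N                         ∎

  fromℕ≤[1+cε]d : ∀ c {L d} → f * L ≤ (f + c * e) * d → fromℕ L ℚ.≤ (1ℚ ℚ.+ fromℕ c ℚ.* ε) ℚ.* fromℕ d
  fromℕ≤[1+cε]d c {L} {d} fL≤ = cancel (begin
    fromℕ f ℚ.* fromℕ L                           ≡⟨ fromℕ-* f L ⟨
    fromℕ (f * L)                                 ≤⟨ fromℕ-mono-≤ fL≤ ⟩
    fromℕ ((f + c * e) * d)                       ≡⟨ fromℕ-* (f + c * e) d ⟩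
    fromℕ (f + c * e) ℚ.* fromℕ d                 ≡⟨ cong (ℚ._* fromℕ d) (fromℤ-+ (+ f) (+ (c * e))) ⟩
    (fromℕ f ℚ.+ fromℕ (c * e)) ℚ.* fromℕ d       ≡⟨ cong (λ x → (fromℕ f ℚ.+ x) ℚ.* fromℕ d) (fromℕ-* c e) ⟩
    (fromℕ f ℚ.+ fromℕ c ℚ.* fromℕ e) ℚ.* fromℕ d ≡⟨ cong (λ x → (fromℕ f ℚ.+ fromℕ c ℚ.* x) ℚ.* fromℕ d) fε≡e ⟨
    (fromℕ f ℚ.+ fromℕ c ℚ.* (fromℕ f ℚ.* ε)) ℚ.* fromℕ d
      ≡⟨ solve 4 (λ f c ε d → (f :+ c :* (f :* ε)) :* d := f :* ((con 1ℚ :+ c :* ε) :* d)) refl (fromℕ f) (fromℕ c) ε (fromℕ d) ⟩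
    fromℕ f ℚ.* ((1ℚ ℚ.+ fromℕ c ℚ.* ε) ℚ.* fromℕ d) ∎)

-- The two levels

offset : ∀ b N {x} → b ≤ x → x < b + N → ∃ λ (ℓ : Fin N) → b + toℕ ℓ ≡ x
offset b N {x} b≤x x<b+N = fromℕ< x∸b<N , trans (cong (_+_ b) (Fin.toℕ-fromℕ< x∸b<N)) (ℕ.m+[n∸m]≡n b≤x)
  where
  x∸b<N : x ∸ b < N
  x∸b<N = ℕ.+-cancelˡ-< b _ _ (subst (_< b + N) (sym (ℕ.m+[n∸m]≡n b≤x)) x<b+N)

toℕ-combine′ : ∀ {m n} (i : Fin m) (j : Fin n) → toℕ (combine i j) ≡ toℕ i * n + toℕ j
toℕ-combine′ {n = n} i j = trans (Fin.toℕ-combine i j) (cong (_+ toℕ j) (ℕ.*-comm n (toℕ i)))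

toℕ-combine-combine : ∀ {l m n} (i : Fin l) (j : Fin m) (k : Fin n) →
                      toℕ (combine i (combine j k)) ≡ toℕ i * (m * n) + toℕ j * n + toℕ k
toℕ-combine-combine {m = m} {n} i j k =
  trans (toℕ-combine′ i (combine j k))
    (trans (cong (_+_ (toℕ i * (m * n))) (toℕ-combine′ j k)) (sym (ℕ.+-assoc (toℕ i * (m * n)) _ _)))

lookup-indexString : ∀ {q₁ q₂ M₁ M₂ N₂} (C₂ : Code q₂ N₂ M₂) (C₁ : Code q₁ (M₂ * N₂) M₁) i j ℓ →
                     lookup (indexString C₂ C₁) (combine i (combine j ℓ)) ≡
                     (lookup (codeword C₁ i) (combine j ℓ) , lookup (codeword C₂ j) ℓ)
lookup-indexString {M₁ = M₁} C₂ C₁ i j ℓ =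
  trans (lookup-zip (combine i (combine j ℓ)) (concatenation C₁) (concat (replicate M₁ (concatenation C₂)))) (cong₂ _,_
    (trans (lookup-concat (tabulate (codeword C₁)) i (combine j ℓ))
           (cong (λ c → lookup c (combine j ℓ)) (lookup∘tabulate (codeword C₁) i)))
    (begin
      lookup (concat (replicate M₁ (concatenation C₂))) (combine i (combine j ℓ))
        ≡⟨ lookup-concat (replicate M₁ (concatenation C₂)) i (combine j ℓ) ⟩
      lookup (lookup (replicate M₁ (concatenation C₂)) i) (combine j ℓ)
        ≡⟨ cong (λ c → lookup c (combine j ℓ)) (lookup-replicate i (concatenation C₂)) ⟩
      lookup (concatenation C₂) (combine j ℓ)
        ≡⟨ lookup-concat (tabulate (codeword C₂)) j ℓ ⟩
      lookup (lookup (tabulate (codeword C₂)) j) ℓ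
        ≡⟨ cong (λ c → lookup c ℓ) (lookup∘tabulate (codeword C₂) j) ⟩
      lookup (codeword C₂ j) ℓ ∎))
  where open ≡-Reasoning

within-window : ∀ {a t x y} → a ≤ x → y ≤ a + t → y ≤ x + t
within-window {t = t} a≤x y≤a+t = ℕ.≤-trans y≤a+t (ℕ.+-monoˡ-≤ t a≤x)

module _ {ε : ℚ} {e f : ℕ} (ε≡e/f : IsFraction ε e f) (0<e : 0 < e) (121e≤f : 121 * e ≤ f) where
  open Refinement e f 0<e 121e≤f

  decodes : ∀ {q N M L} {C : Code q N M} (Dec : ListDecoder C ε L) (j : Fin M) (y : Vec (Fin q) N) {a b} →
            Path (At a b (Same (codeword C j) y)) u v u′ v′ D E → e * N ≤ f * E → j ∈ dec Dec (toList y)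
  decodes {C = C} Dec j y α eN≤fE with μ , nc , refl ← fromPath α =
    Equivalence.from (spec Dec (toList y) j)
      ( operations y μ , run-operations nc (codeword C j) y id
      , fromℕ≤N[1-ε] ε≡e/f (#deletions-operations nc y) eN≤fE
      , fromℕ≤N[1-ε] ε≡e/f (#insertions-operations nc y) eN≤fE )

  module Correctness
    (0<ε : 0ℚ ℚ.< ε) {A : Set} {q₁ q₂ M₁ M₂ N₂ L₁ L₂ : ℕ}
    (C₂ : Code q₂ N₂ M₂) (C₁ : Code q₁ (M₂ * N₂) M₁)
    (Dec₁ : ListDecoder C₁ ε L₁) (Dec₂ : ListDecoder C₂ ε L₂)
    (m : Vec A (M₁ * (M₂ * N₂))) (n : ℕ) (S′ : Vec (Symbol A q₁ q₂) (n * (M₂ * N₂)))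
    where

    N₁ : ℕ
    N₁ = M₂ * N₂

    S : Vec (Symbol A q₁ q₂) (M₁ * N₁)
    S = zip m (indexString C₂ C₁)

    open EnhancedEDApprox 0<ε Dec₁ Dec₂ S n S′

    Match : ℕ → ℕ → Set
    Match = At 0 0 (Same S S′)

    index₁-lookup : ∀ (k : Fin M₁) (x : Fin N₁) {y} → lookup S (combine k x) ≡ y →
                    lookup (codeword C₁ k) x ≡ proj₁ (proj₂ y)
    index₁-lookup k x refl with j , ℓ , refl ← Fin.combine-surjective {M₂} {N₂} x = sym (cong proj₁ (trans
      (cong proj₂ (lookup-zip (combine k (combine j ℓ)) m (indexString C₂ C₁)))
      (lookup-indexString C₂ C₁ k j ℓ)))

    index₂-lookup : ∀ (k : Fin M₁) j (ℓ : Fin N₂) {y} → lookup S (combine k (combine j ℓ)) ≡ y →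
                    lookup (codeword C₂ j) ℓ ≡ proj₂ (proj₂ y)
    index₂-lookup k j ℓ refl = sym (cong proj₂ (trans
      (cong proj₂ (lookup-zip (combine k (combine j ℓ)) m (indexString C₂ C₁)))
      (lookup-indexString C₂ C₁ k j ℓ)))

    lookup-block : ∀ i x → lookup (block i) x ≡ lookup S′ (combine i x)
    lookup-block i x = lookup∘tabulate (λ x → lookup S′ (combine i x)) x

    lookup-subBlock : ∀ i i′ x → lookup (subBlock i i′) x ≡ lookup S′ (combine i (combine i′ x))
    lookup-subBlock i i′ x =
      trans (lookup∘tabulate (λ x → lookup (block i) (combine i′ x)) x) (lookup-block i (combine i′ x))

    Match⇒index₁ : (k : Fin M₁) (i : Fin n) → ∀ {x y} →
               toℕ k * N₁ ≤ x → x < suc (toℕ k) * N₁ → toℕ i * N₁ ≤ y → y < suc (toℕ i) * N₁ → Match x y →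
               At (toℕ k * N₁) (toℕ i * N₁) (Same (codeword C₁ k) (Vec.map (proj₁ ∘ proj₂) (block i))) x y
    Match⇒index₁ k i {x} {y} x≥ x< y≥ y< (u , v , refl , refl , eq)
      with x′ , x≡ ← offset (toℕ k * N₁) N₁ x≥ (subst (x <_) (ℕ.+-comm N₁ _) x<)
         | y′ , y≡ ← offset (toℕ i * N₁) N₁ y≥ (subst (y <_) (ℕ.+-comm N₁ _) y<)
      with refl ← Fin.toℕ-injective {i = u} {combine k x′} (trans (sym x≡) (sym (toℕ-combine′ k x′)))
         | refl ← Fin.toℕ-injective {i = v} {combine i y′} (trans (sym y≡) (sym (toℕ-combine′ i y′))) =
      x′ , y′ , x≡ , y≡ , (begin
        lookup (codeword C₁ k) x′                         ≡⟨ index₁-lookup k x′ eq ⟩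
        proj₁ (proj₂ (lookup S′ (combine i y′)))          ≡⟨ cong (λ (x : Symbol A q₁ q₂) → proj₁ (proj₂ x)) (lookup-block i y′) ⟨
        proj₁ (proj₂ (lookup (block i) y′))               ≡⟨ lookup-map y′ (proj₁ ∘ proj₂) (block i) ⟨
        lookup (Vec.map (proj₁ ∘ proj₂) (block i)) y′     ∎)
      where open ≡-Reasoning

    Match⇒index₂ : (k : Fin M₁) (j : Fin M₂) (i : Fin n) (i′ : Fin M₂) → let b = toℕ k * N₁ + toℕ j * N₂ in
               ∀ {x y} → b ≤ x → x < b + N₂ →
               toℕ i * N₁ + toℕ i′ * N₂ ≤ y → y < toℕ i * N₁ + toℕ i′ * N₂ + N₂ → Match x y →
               At b (toℕ i * N₁ + toℕ i′ * N₂)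
                  (Same (codeword C₂ j) (Vec.map (proj₂ ∘ proj₂) (subBlock i i′))) x y
    Match⇒index₂ k j i i′ {x} {y} x≥ x< y≥ y< (u , v , refl , refl , eq)
      with x′ , x≡ ← offset (toℕ k * N₁ + toℕ j * N₂) N₂ x≥ x<
         | y′ , y≡ ← offset (toℕ i * N₁ + toℕ i′ * N₂) N₂ y≥ y<
      with refl ← Fin.toℕ-injective {i = u} {combine k (combine j x′)}
                    (trans (sym x≡) (sym (toℕ-combine-combine k j x′)))
         | refl ← Fin.toℕ-injective {i = v} {combine i (combine i′ y′)}
                    (trans (sym y≡) (sym (toℕ-combine-combine i i′ y′))) =
      x′ , y′ , x≡ , y≡ , (begin
        lookup (codeword C₂ j) x′                              ≡⟨ index₂-lookup k j x′ eq ⟩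
        proj₂ (proj₂ (lookup S′ (combine i (combine i′ y′))))  ≡⟨ cong (λ (x : Symbol A q₁ q₂) → proj₂ (proj₂ x)) (lookup-subBlock i i′ y′) ⟨
        proj₂ (proj₂ (lookup (subBlock i i′) y′))              ≡⟨ lookup-map y′ (proj₂ ∘ proj₂) (subBlock i i′) ⟨
        lookup (Vec.map (proj₂ ∘ proj₂) (subBlock i i′)) y′    ∎)
      where open ≡-Reasoning

    module _ (i : Fin n) {p q : ℕ} (q≤ : q ≤ M₁ * N₁)
             (good₁ : Good Match N₁ p (toℕ i * N₁) q (suc (toℕ i) * N₁)) where

      private module G₁ = Good good₁

      j : Fin M₁
      j = fromℕ< {G₁.c} (ℕ.*-cancelʳ-< N₁ _ _
            (ℕ.≤-<-trans G₁.cN≤u₁ (ℕ.<-≤-trans G₁.u₁<u₂ (ℕ.≤-trans G₁.u₂≤u′ q≤))))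

      toℕ-j : toℕ j ≡ G₁.c
      toℕ-j = Fin.toℕ-fromℕ< _

      j∈ : j ∈ dec Dec₁ (index₁ i)
      j∈ = decodes Dec₁ j _ (path-map G₁.path λ x≥ x< y≥ y< → Match⇒index₁ j i
             (ℕ.≤-trans (ℕ.≤-reflexive (cong (_* N₁) toℕ-j)) (ℕ.≤-trans G₁.cN≤u₁ x≥))
             (ℕ.<-≤-trans x< (ℕ.≤-trans G₁.u₂≤ (ℕ.≤-reflexive (cong (λ c → suc c * N₁) (sym toℕ-j)))))
             (ℕ.≤-trans G₁.v≤v₁ y≥) (ℕ.<-≤-trans y< G₁.v₂≤v′)) G₁.heavy

      module _ (i′ : Fin M₂) {p₂ q₂ : ℕ} (p≤p₂ : p ≤ p₂) (q₂≤q : q₂ ≤ q)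
               (good₂ : Good Match N₂ p₂ (toℕ i * N₁ + toℕ i′ * N₂) q₂ (toℕ i * N₁ + suc (toℕ i′) * N₂)) where

        private module G₂ = Good good₂

        c<M₁M₂ : G₂.c < M₁ * M₂
        c<M₁M₂ = ℕ.*-cancelʳ-< N₂ _ _ (subst (G₂.c * N₂ <_) (sym (ℕ.*-assoc M₁ M₂ N₂))
          (ℕ.≤-<-trans G₂.cN≤u₁ (ℕ.<-≤-trans G₂.u₁<u₂ (ℕ.≤-trans G₂.u₂≤u′ (ℕ.≤-trans q₂≤q q≤)))))

        k : Fin M₁
        k = proj₁ (remQuot {M₁} M₂ (fromℕ< c<M₁M₂))

        j′ : Fin M₂
        j′ = proj₂ (remQuot {M₁} M₂ (fromℕ< c<M₁M₂))

        c≡ : toℕ k * M₂ + toℕ j′ ≡ G₂.c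
        c≡ = trans (sym (toℕ-combine′ k j′))
          (trans (cong toℕ (Fin.combine-remQuot {M₁} M₂ (fromℕ< c<M₁M₂))) (Fin.toℕ-fromℕ< c<M₁M₂))

        cN₂≡ : toℕ k * N₁ + toℕ j′ * N₂ ≡ G₂.c * N₂
        cN₂≡ = trans (lemma (toℕ k) M₂ (toℕ j′) N₂) (cong (_* N₂) c≡)
          where
          lemma : ∀ k M j N → k * (M * N) + j * N ≡ (k * M + j) * N
          lemma = solve-∀

        j′∈ : j′ ∈ dec Dec₂ (index₂ i i′)
        j′∈ = decodes Dec₂ j′ _ (path-map G₂.path λ x≥ x< y≥ y< → Match⇒index₂ k j′ i i′
          (ℕ.≤-trans (ℕ.≤-reflexive cN₂≡) (ℕ.≤-trans G₂.cN≤u₁ x≥))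
          (ℕ.<-≤-trans x< (ℕ.≤-trans G₂.u₂≤ (ℕ.≤-reflexive (trans (ℕ.+-comm N₂ _) (cong (_+ N₂) (sym cN₂≡))))))
          (ℕ.≤-trans G₂.v≤v₁ y≥)
          (ℕ.<-≤-trans y< (ℕ.≤-trans G₂.v₂≤v′ (ℕ.≤-reflexive (lemma (toℕ i * N₁) (toℕ i′ * N₂) N₂))))) G₂.heavy
          where
          lemma : ∀ a b c → a + (c + b) ≡ a + b + c
          lemma = solve-∀

        open ℕ.≤-Reasoning

        a₁≤k : G₁.a ≤ toℕ k
        a₁≤k = ℕ.≤-pred (ℕ.*-cancelʳ-< N₁ _ _ (begin-strict
          G₁.a * N₁                          ≤⟨ G₁.aN≤u ⟩
          p                                  ≤⟨ p≤p₂ ⟩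
          p₂                                 ≤⟨ G₂.u≤u₁ ⟩
          G₂.u₁                              <⟨ G₂.u₁<u₂ ⟩
          G₂.u₂                              ≤⟨ G₂.u₂≤ ⟩
          suc G₂.c * N₂                      ≡⟨ ℕ.+-comm N₂ _ ⟩
          G₂.c * N₂ + N₂                     ≡⟨ cong (_+ N₂) cN₂≡ ⟨
          toℕ k * N₁ + toℕ j′ * N₂ + N₂      ≡⟨ lemma (toℕ k * N₁) (toℕ j′) N₂ ⟩
          toℕ k * N₁ + suc (toℕ j′) * N₂     ≤⟨ ℕ.+-monoʳ-≤ (toℕ k * N₁) (ℕ.*-monoˡ-≤ N₂ (Fin.toℕ<n j′)) ⟩
          toℕ k * N₁ + N₁                    ≡⟨ ℕ.+-comm _ N₁ ⟩
          suc (toℕ k) * N₁                   ∎))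
          where
          lemma : ∀ x j N → x + j * N + N ≡ x + suc j * N
          lemma = solve-∀

        k≤a₁+t₁ : toℕ k ≤ G₁.a + G₁.t
        k≤a₁+t₁ = ℕ.≤-pred (ℕ.*-cancelʳ-< N₁ _ _ (begin-strict
          toℕ k * N₁                     ≤⟨ ℕ.m≤m+n _ _ ⟩
          toℕ k * N₁ + toℕ j′ * N₂       ≡⟨ cN₂≡ ⟩
          G₂.c * N₂                      ≤⟨ G₂.cN≤u₁ ⟩
          G₂.u₁                          <⟨ G₂.u₁<u₂ ⟩
          G₂.u₂                          ≤⟨ G₂.u₂≤u′ ⟩
          q₂                             ≤⟨ q₂≤q ⟩
          q                              ≤⟨ G₁.u′≤ ⟩
          suc (G₁.a + G₁.t) * N₁         ∎))

        k∈ : InWindow w (+ toℕ j) (+ toℕ k)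
        k∈ = subst (λ c → InWindow w (+ c) (+ toℕ k)) (sym toℕ-j)
          (inWindow (fromℕ≤1/ε ε≡e/f 0<ε G₁.t G₁.te≤f)
            (+≤+ (within-window a₁≤k G₁.c≤a+t)) (+≤+ (within-window G₁.a≤c k≤a₁+t₁)))

        edge : ∀ {x y} → p₂ ≤ x → x < q₂ →
               toℕ i * N₁ + toℕ i′ * N₂ ≤ y → y < toℕ i * N₁ + suc (toℕ i′) * N₂ →
               Match x y → At 0 0 G x y
        edge {x} {y} x≥ x< y≥ y< (u , v , refl , refl , eq) = u , v , refl , refl , record
          { i = i ; j = j ; j∈ = j∈ ; k = k ; k∈ = k∈ ; i′ = i′ ; j′ = j′ ; j′∈ = j′∈
          ; k′ = k′ ; k′∈ = k′∈
          ; u∈ = ℓ , u≡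
          ; v∈ = ℓ′ , Fin.toℕ-injective (trans (sym v≡) (sym (toℕ-combine-combine i i′ ℓ′)))
          ; equal = eq }
          where
          instance _ = >-nonZero G₂.0<N
          s = x ℕ./ N₂
          k′ = + s ℤ.- + (toℕ k * M₂)

          sN₂≤x : s * N₂ ≤ x
          sN₂≤x = ℕ.m/n*n≤m x N₂

          x<sN₂+N₂ : x < s * N₂ + N₂
          x<sN₂+N₂ = begin-strict
            x                     ≡⟨ ℕ.m≡m%n+[m/n]*n x N₂ ⟩
            x ℕ.% N₂ + s * N₂     <⟨ ℕ.+-monoˡ-< (s * N₂) (ℕ.m%n<n x N₂) ⟩
            N₂ + s * N₂           ≡⟨ ℕ.+-comm N₂ _ ⟩
            s * N₂ + N₂           ∎

          a₂≤s : G₂.a ≤ s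
          a₂≤s = ℕ.≤-pred (ℕ.*-cancelʳ-< N₂ _ _ (ℕ.≤-<-trans G₂.aN≤u
            (ℕ.≤-<-trans x≥ (ℕ.<-≤-trans x<sN₂+N₂ (ℕ.≤-reflexive (ℕ.+-comm _ N₂))))))

          s≤a₂+t₂ : s ≤ G₂.a + G₂.t
          s≤a₂+t₂ = ℕ.≤-pred (ℕ.*-cancelʳ-< N₂ _ _ (ℕ.≤-<-trans sN₂≤x (ℕ.<-≤-trans x< G₂.u′≤)))

          j′≡ : + G₂.c ℤ.- + (toℕ k * M₂) ≡ + toℕ j′
          j′≡ = trans (cong (λ c → + c ℤ.- + (toℕ k * M₂)) (sym c≡)) (lemma (+ (toℕ k * M₂)) (+ toℕ j′))
            where
            lemma : ∀ a b → a ℤ.+ b ℤ.- a ≡ b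
            lemma = ℤ-Solver.solve-∀

          swap : ∀ a b c → a ℤ.+ b ℤ.- c ≡ a ℤ.- c ℤ.+ b
          swap = ℤ-Solver.solve-∀

          k′∈ : InWindow w (+ toℕ j′) k′
          k′∈ = subst (λ c → InWindow w c k′) j′≡ (inWindow {z = k′} (fromℕ≤1/ε ε≡e/f 0<ε G₂.t G₂.te≤f)
            (subst (+ G₂.c ℤ.- + (toℕ k * M₂) ℤ.≤_) (swap (+ s) (+ G₂.t) (+ (toℕ k * M₂)))
              (ℤ.+-monoˡ-≤ (ℤ.- + (toℕ k * M₂)) (+≤+ (within-window a₂≤s G₂.c≤a+t))))
            (subst (k′ ℤ.≤_) (swap (+ G₂.c) (+ G₂.t) (+ (toℕ k * M₂)))
              (ℤ.+-monoˡ-≤ (ℤ.- + (toℕ k * M₂)) (+≤+ (within-window G₂.a≤c s≤a₂+t₂)))))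

          ℓ : Fin N₂
          ℓ = proj₁ (offset (s * N₂) N₂ sN₂≤x x<sN₂+N₂)

          u≡ : + x ≡ + (toℕ k * N₁) ℤ.+ k′ ℤ.* + N₂ ℤ.+ + toℕ ℓ
          u≡ = ≡.begin
            + x                                                              ≡.≡⟨ cong +_ (proj₂ (offset (s * N₂) N₂ sN₂≤x x<sN₂+N₂)) ⟨
            + (s * N₂) ℤ.+ + toℕ ℓ                                           ≡.≡⟨ cong (ℤ._+ + toℕ ℓ) (ℤ.pos-* s N₂) ⟩
            + s ℤ.* + N₂ ℤ.+ + toℕ ℓ                                         ≡.≡⟨ lemma (+ (toℕ k * M₂)) (+ s) (+ N₂) (+ toℕ ℓ) ⟩
            + (toℕ k * M₂) ℤ.* + N₂ ℤ.+ k′ ℤ.* + N₂ ℤ.+ + toℕ ℓ              ≡.≡⟨ cong (λ z → z ℤ.+ k′ ℤ.* + N₂ ℤ.+ + toℕ ℓ)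
                                                                                    (trans (sym (ℤ.pos-* (toℕ k * M₂) N₂)) (cong +_ (ℕ.*-assoc (toℕ k) M₂ N₂))) ⟩
            + (toℕ k * N₁) ℤ.+ k′ ℤ.* + N₂ ℤ.+ + toℕ ℓ                       ≡.∎
            where
            module ≡ = ≡-Reasoning
            lemma : ∀ a s N ℓ → s ℤ.* N ℤ.+ ℓ ≡ a ℤ.* N ℤ.+ (s ℤ.- a) ℤ.* N ℤ.+ ℓ
            lemma = ℤ-Solver.solve-∀

          y<+N₂ : y < toℕ i * N₁ + toℕ i′ * N₂ + N₂
          y<+N₂ = ℕ.<-≤-trans y< (ℕ.≤-reflexive (lemma (toℕ i * N₁) (toℕ i′ * N₂) N₂))
            where
            lemma : ∀ a b c → a + (c + b) ≡ a + b + c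
            lemma = solve-∀

          ℓ′ : Fin N₂
          ℓ′ = proj₁ (offset _ N₂ y≥ y<+N₂)

          v≡ : toℕ i * N₁ + toℕ i′ * N₂ + toℕ ℓ′ ≡ y
          v≡ = proj₂ (offset _ N₂ y≥ y<+N₂)

    refine-subBlock : (i : Fin n) {p q : ℕ} → q ≤ M₁ * N₁ →
      Good Match N₁ p (toℕ i * N₁) q (suc (toℕ i) * N₁) →
      ∀ {p₂ q₂ D E} (i′ : Fin M₂) → p ≤ p₂ → q₂ ≤ q →
      Path Match p₂ (toℕ i * N₁ + toℕ i′ * N₂) q₂ (toℕ i * N₁ + suc (toℕ i′) * N₂) D E →
      Refined (At 0 0 G) p₂ (toℕ i * N₁ + toℕ i′ * N₂) q₂ (toℕ i * N₁ + suc (toℕ i′) * N₂) D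
    refine-subBlock i q≤ good₁ i′ p≤p₂ q₂≤q β
      with good⊎cheap N₂ (lemma (toℕ i * N₁) (toℕ i′ * N₂) N₂) β
      where
      lemma : ∀ a b c → a + (c + b) ≡ a + b + c
      lemma = solve-∀
    ... | inj₁ good₂ = kept (path-map β (edge i q≤ good₁ i′ p≤p₂ q₂≤q good₂))
    ... | inj₂ cheap = refined (straighten β) cheap

    refine-block : ∀ {p q D E} (i : Fin n) → q ≤ M₁ * N₁ →
      Path Match p (toℕ i * N₁) q (suc (toℕ i) * N₁) D E →
      Refined (At 0 0 G) p (toℕ i * N₁) q (suc (toℕ i) * N₁) D
    refine-block {p} {q} {D} {E} i q≤ β with good⊎cheap N₁ (ℕ.+-comm N₁ (toℕ i * N₁)) β
    ... | inj₂ cheap = refined (straighten β) cheap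
    ... | inj₁ good₁ =
      subst (λ y → Refined (At 0 0 G) p (toℕ i * N₁) q y D) (ℕ.+-comm (toℕ i * N₁) N₁)
        (refine-blocks N₂ M₂ (refine-subBlock i q≤ good₁)
          (subst (λ y → Path Match p (toℕ i * N₁) q y D E) (ℕ.+-comm N₁ (toℕ i * N₁)) β))

    refine : Path Match 0 0 (M₁ * N₁) (n * N₁) D E → Refined (At 0 0 G) 0 0 (M₁ * N₁) (n * N₁) D
    refine = refine-blocks {v = 0} N₁ n λ i _ q≤ → refine-block i q≤

    module _ {μ} (returned : Returns μ) where
      open LargestNonCrossing returned

      operations-correct : run (operations S′ μ) (toList S) ≡ toList S′
      operations-correct = run-operations nonCrossing S S′ G.equal

      length-operations : (M₁ * N₁) + (n * N₁) ≡ length (operations S′ μ) + 2 * length μ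
      length-operations = begin
        M₁ * N₁ + n * N₁
          ≡⟨ cong₂ _+_ (#deletions-operations nonCrossing S′) (#insertions-operations nonCrossing S′) ⟨
        #deletions os + length μ + (#insertions os + length μ)
          ≡⟨ lemma (#deletions os) (#insertions os) (length μ) ⟩
        #deletions os + #insertions os + 2 * length μ
          ≡⟨ cong (_+ 2 * length μ) (length≡#deletions+#insertions os) ⟨
        length os + 2 * length μ ∎
        where
        open ≡-Reasoning
        os = operations S′ μ
        lemma : ∀ a b c → a + c + (b + c) ≡ a + b + 2 * c
        lemma = solve-∀

      shortest : Path (At 0 0 G) 0 0 (M₁ * N₁) (n * N₁) D E → length (operations S′ μ) ≤ D
      shortest {D} {E} π with ν , nc , refl ← fromPath π = ℕ.+-cancelʳ-≤ (2 * length μ) _ _ (begin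
        length (operations S′ μ) + 2 * length μ ≡⟨ length-operations ⟨
        M₁ * N₁ + n * N₁                        ≡⟨ path-+ π ⟨
        D + 2 * length ν + 0                    ≡⟨ ℕ.+-identityʳ _ ⟩
        D + 2 * length ν                        ≤⟨ ℕ.+-monoʳ-≤ D (ℕ.*-monoʳ-≤ 2 (largest ν nc)) ⟩
        D + 2 * length μ                        ∎)
        where open ℕ.≤-Reasoning

      approximates : ∀ os → run os (toList S) ≡ toList S′ →
                     f * length (operations S′ μ) ≤ (f + 23 * e) * length os
      approximates os eq with D , E , D≤ , π ← run⇒path S S′ os eq with refined {d} ρ cheap ← refine π = begin
        f * length (operations S′ μ) ≤⟨ ℕ.*-monoʳ-≤ f (shortest ρ) ⟩
        f * d                        ≤⟨ cheap ⟩
        (f + 23 * e) * D             ≤⟨ ℕ.*-monoʳ-≤ (f + 23 * e) D≤ ⟩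
        (f + 23 * e) * length os     ∎
        where open ℕ.≤-Reasoning

theorem5p3 : ∀ {A : Set} {q₁ q₂ M₁ M₂ N₂ L₁ L₂ : ℕ}
    {ε : ℚ} (0<ε : 0ℚ ℚ.< ε) (ε<1/121 : ε ℚ.< + 1 / 121)
    (C₂ : Code q₂ N₂ M₂) (C₁ : Code q₁ (M₂ ℕ.* N₂) M₁)
    (Dec₁ : ListDecoder C₁ ε L₁) (Dec₂ : ListDecoder C₂ ε L₂)
    (m  : Vec A (M₁ ℕ.* (M₂ ℕ.* N₂)))
    (n : ℕ) (S′ : Vec (Symbol A q₁ q₂) (n ℕ.* (M₂ ℕ.* N₂))) →
    let S = zip m (indexString C₂ C₁) in
    ∀ μ → EnhancedEDApprox.Returns 0<ε Dec₁ Dec₂ S n S′ μ →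
    run (operations S′ μ) (toList S) ≡ toList S′ ×
    (∀ d → IsED (toList S) (toList S′) d →
    fromℕ (length (operations S′ μ)) ℚ.≤ (1ℚ ℚ.+ (+ 23 / 1) ℚ.* ε) ℚ.* fromℕ d)
theorem5p3 {ε = ε} 0<ε ε<1/121 C₂ C₁ Dec₁ Dec₂ m n S′ μ returned
  with ε≡e/f , 0<e , 121e≤f ← fraction ε 0<ε ε<1/121 =
  operations-correct returned , λ { _ ((os , eq , refl) , _) → fromℕ≤[1+cε]d ε≡e/f 23 (approximates returned os eq) }
  where open Correctness ε≡e/f 0<e 121e≤f 0<ε C₂ C₁ Dec₁ Dec₂ m n S′
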